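{- Let $\mathcal{P}$ be a $d$-dimensional integral polytope with Ehrhart polynomial $i(\mathcal{P},t)=1+\sum_{i=1}^{d}c_it^i$, where each $c_i\neq0$. Then there exists a $(d+2)$-dimensional integral polytope $\mathcal{Q}$ with Ehrhart polynomial $i(\mathcal{Q},t)=1+\sum_{i=1}^{d+2}h_it^i$ such that $\mathrm{sgn}(h_i)=\mathrm{sgn}(c_{i-2})$ for all $4\le i\le d$, $\mathrm{sgn}(h_2)=+1$, and $\mathrm{sgn}(h_1)=\mathrm{sgn}(h_3)=\mathrm{sgn}(c_1)$.
   Context: An integral polytope is a convex polytope all of whose vertices have integer coordinates. For an integral polytope $\mathcal{P}\subseteq\mathbb{R}^N$ of dimension $d$, $i(\mathcal{P},t)=|t\mathcal{P}\cap\mathbb{Z}^N|$ ($t$ a positive integer) is a polynomial in $t$ of degree $d$ with constant term $1$, the Ehrhart polynomial. $\mathrm{sgn}(x)\in\{ -1,0,+1\}$ denotes the sign of a real number $x$, with $\mathrm{sgn}(0)=0$. Throughout, dimensions $d$ are assumed to satisfy $d\ge3$. -}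

module Defs where

open import Data.Nat as ℕ using (ℕ; zero; suc)
open import Data.Integer as ℤ using (ℤ; +_; -[1+_]; +[1+_])
open import Data.Rational as ℚ using (ℚ; 0ℚ; 1ℚ; _/_; _≤_; _+_; _*_)
open import Data.Fin using (Fin; zero; suc)
open import Data.Vec as Vec using (Vec; replicate; zipWith)
open import Data.List using (List; length)
open import Data.List.Membership.Propositional using (_∈_)
open import Data.List.Relation.Unary.Unique.Propositional using (Unique)
open import Data.Product using (Σ; Σ-syntax; _×_)
open import Relation.Binary.PropositionalEquality using (_≡_)
open import Relation.Nullary using (¬_)

ℤ→ℚ : ℤ → ℚ
ℤ→ℚ n = n / 1

ℕ→ℚ : ℕ → ℚ
ℕ→ℚ n = (+ n) / 1

sumℚ : ∀ {n} → (Fin n → ℚ) → ℚ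
sumℚ {zero}  f = 0ℚ
sumℚ {suc n} f = f zero + sumℚ (λ i → f (suc i))

_⊕_ : ∀ {N} → Vec ℚ N → Vec ℚ N → Vec ℚ N
_⊕_ = zipWith _+_

_•_ : ∀ {N} → ℚ → Vec ℚ N → Vec ℚ N
a • v = Vec.map (a *_) v

vsum : ∀ {n N} → (Fin n → Vec ℚ N) → Vec ℚ N
vsum {zero}  f = replicate _ 0ℚ
vsum {suc n} f = f zero ⊕ vsum (λ i → f (suc i))

toℚ^ : ∀ {N} → Vec ℤ N → Vec ℚ N
toℚ^ = Vec.map ℤ→ℚ

-- An integral polytope in ℝ^N is given as conv(V) for a finite family
-- V : Fin k → ℤ^N of integer points (its vertices are among them).
-- x ∈ t·conv(V): x = Σ λ_j V_j with λ_j ≥ 0 rational and Σ λ_j = t.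
InDilate : ∀ {k N} → (Fin k → Vec ℤ N) → ℕ → Vec ℤ N → Set
InDilate {k} V t x =
  Σ[ λ′ ∈ (Fin k → ℚ) ]
    ((∀ j → 0ℚ ≤ λ′ j) × (sumℚ λ′ ≡ ℕ→ℚ t) ×
     (vsum (λ j → λ′ j • toℚ^ (V j)) ≡ toℚ^ x))

AffIndep : ∀ {m N} → (Fin m → Vec ℚ N) → Set
AffIndep {m} {N} p =
  (μ : Fin m → ℚ) → sumℚ μ ≡ 0ℚ →
  vsum (λ i → μ i • p i) ≡ replicate N 0ℚ → ∀ i → μ i ≡ 0ℚ

HasDim : ∀ {k N} → (Fin k → Vec ℤ N) → ℕ → Set
HasDim {k} V d =
  (Σ[ ι ∈ (Fin (suc d) → Fin k) ] AffIndep (λ i → toℚ^ (V (ι i)))) ×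
  ((ι : Fin (suc (suc d)) → Fin k) → ¬ AffIndep (λ i → toℚ^ (V (ι i))))

LatticeCount : ∀ {k N} → (Fin k → Vec ℤ N) → ℕ → ℕ → Set
LatticeCount {k} {N} V t n =
  Σ[ L ∈ List (Vec ℤ N) ]
    (Unique L × (∀ x → (x ∈ L → InDilate V t x) × (InDilate V t x → x ∈ L)) ×
     (length L ≡ n))

_^ℚ_ : ℚ → ℕ → ℚ
a ^ℚ zero  = 1ℚ
a ^ℚ suc n = a * (a ^ℚ n)

polyTail : ℕ → (ℕ → ℚ) → ℚ → ℚ
polyTail zero    c x = 0ℚ
polyTail (suc d) c x = polyTail d c x + c (suc d) * (x ^ℚ suc d)

IsEhrhart : ∀ {k N} → (Fin k → Vec ℤ N) → (d : ℕ) → (ℕ → ℚ) → Set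
IsEhrhart V d c =
  ∀ t → 1 ℕ.≤ t →
  Σ[ n ∈ ℕ ] (LatticeCount V t n × (ℕ→ℚ n ≡ 1ℚ + polyTail d c (ℕ→ℚ t)))

sgn : ℚ → ℤ
sgn q with ℚ.numerator q
... | + zero    = + 0
... | +[1+ _ ]  = + 1
... | -[1+ _ ]  = -[1+ 0 ]

{-# OPTIONS --safe #-}

-- The polytope is the product of a dilate mP with the parallelogram R_n spanned by (1,0) and (1,n),
-- whose Ehrhart polynomial is 1 + 2t + nt². Its coefficients are therefore
-- h_i = mⁱc_i + 2mⁱ⁻¹c_{i-1} + n mⁱ⁻²c_{i-2} with c_0 = 1, and h_1 = m c_1 + 2. A large m makes c_1
-- decide the sign of h_1, and then a large n makes c_{i-2} decide the sign of h_i for i ≥ 2.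
module Submission where

open import Defs
open import Data.Nat as ℕ using (ℕ; zero; suc; _≤_; _<_; _∸_; _+_; _*_; _/_; _%_; _≤?_; z≤n; s≤s; NonZero)
import Data.Nat.DivMod as ℕ÷
import Data.Nat.Properties as ℕₚ
open import Data.Integer as ℤ using (ℤ; +_)
import Data.Integer.Properties as ℤₚ
open import Data.Rational as ℚ using (ℚ; 0ℚ; 1ℚ; 1/_)
  renaming (_+_ to _+ℚ_; _*_ to _*ℚ_; -_ to -ℚ_; _≤_ to _≤ℚ_; _<_ to _<ℚ_)
import Data.Rational.Properties as ℚₚ
open import Data.Rational.Solver using (module +-*-Solver)
open import Data.Rational.Unnormalised as ℚᵘ using (mkℚᵘ; *≤*; *≡*)
import Data.Rational.Unnormalised.Properties as ℚᵘₚ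
open import Data.Fin using (Fin; zero; suc; _↑ˡ_; _↑ʳ_; combine; quotient; remainder; remQuot; splitAt; punchIn; punchOut)
import Data.Fin.Properties as Finₚ
open import Data.Vec as Vec using (Vec; []; _∷_; _++_; lookup)
open import Data.Vec.Properties using (lookup-map; lookup-zipWith; lookup-replicate; tabulate∘lookup; tabulate-cong; lookup-++ˡ; lookup-++ʳ; ++-injective)
open import Data.List as List using (List; length; cartesianProductWith; upTo)
open import Data.List.Properties using (length-map; length-++; length-upTo)
open import Data.List.Membership.Propositional using (_∈_)
open import Data.List.Membership.Propositional.Properties
open import Data.List.Relation.Unary.Unique.Propositional using (Unique)
import Data.List.Relation.Unary.Unique.Propositional.Properties as Uniqueₚ
open import Data.Product using (Σ; Σ-syntax; ∃; _×_; _,_; proj₁; proj₂)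
open import Data.Sum using (_⊎_; inj₁; inj₂) renaming ([_,_]′ to [_,_])
open import Function using (_∘_)
open import Relation.Binary.Definitions using (Tri; tri<; tri≈; tri>)
open import Relation.Binary.PropositionalEquality hiding ([_])
open import Relation.Nullary using (¬_; yes; no; contradiction)
open import Relation.Nullary.Decidable using (decidable-stable)

open +-*-Solver using (solve; _:+_; _:*_; :-_; _:=_; con)

-- By Pick's formula the linear coefficient of a lattice polygon is half the number of its boundary
-- lattice points, hence at least 3/2. A product with a polygon therefore always adds a positive
-- amount to c_1 and can overturn a negative c_1 close to 0; dilating P beforehand enlarges c_1 but
-- not this amount. The edge vectors (1,0) and (1,n) are primitive, so for n ≥ 1 the boundary
-- carries only the four vertices: the area n grows freely while the linear coefficient stays 2.
-- Since h_1 does not involve n, fixing m first and n afterwards is not circular. The hypothesis c_i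
-- ≠ 0 enters through the leading terms: if c_{i-2} were 0, no n would control the sign of h_i.

private variable
  k l m n N M d : ℕ

-- Linear algebra over ℚ

sum-cong : {f g : Fin n → ℚ} → (∀ i → f i ≡ g i) → sumℚ f ≡ sumℚ g
sum-cong {zero}  _  = refl
sum-cong {suc n} eq = cong₂ _+ℚ_ (eq zero) (sum-cong (eq ∘ suc))

sum-zero : {f : Fin n → ℚ} → (∀ i → f i ≡ 0ℚ) → sumℚ f ≡ 0ℚ
sum-zero {zero}  _  = refl
sum-zero {suc n} eq = trans (cong₂ _+ℚ_ (eq zero) (sum-zero (eq ∘ suc))) (ℚₚ.+-identityˡ 0ℚ)

sum-+ : (f g : Fin n → ℚ) → sumℚ (λ i → f i +ℚ g i) ≡ sumℚ f +ℚ sumℚ g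
sum-+ {zero}  f g = refl
sum-+ {suc n} f g = trans (cong (f zero +ℚ g zero +ℚ_) (sum-+ (f ∘ suc) (g ∘ suc)))
  (solve 4 (λ a b c e → (a :+ b) :+ (c :+ e) := (a :+ c) :+ (b :+ e)) refl
    (f zero) (g zero) (sumℚ (f ∘ suc)) (sumℚ (g ∘ suc)))

sum-*ˡ : (a : ℚ) (f : Fin n → ℚ) → sumℚ (λ i → a *ℚ f i) ≡ a *ℚ sumℚ f
sum-*ˡ {zero}  a f = sym (ℚₚ.*-zeroʳ a)
sum-*ˡ {suc n} a f = trans (cong (a *ℚ f zero +ℚ_) (sum-*ˡ a (f ∘ suc)))
  (sym (ℚₚ.*-distribˡ-+ a (f zero) (sumℚ (f ∘ suc))))

sum-*ʳ : (f : Fin n → ℚ) (a : ℚ) → sumℚ (λ i → f i *ℚ a) ≡ sumℚ f *ℚ a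
sum-*ʳ f a = trans (sum-cong (λ i → ℚₚ.*-comm (f i) a))
  (trans (sum-*ˡ a f) (ℚₚ.*-comm a (sumℚ f)))

sum-swap : (f : Fin m → Fin n → ℚ) →
  sumℚ (λ i → sumℚ (λ j → f i j)) ≡ sumℚ (λ j → sumℚ (λ i → f i j))
sum-swap {zero} {n} f = sym (sum-zero {n} (λ _ → refl))
sum-swap {suc m} f = trans (cong (sumℚ (f zero) +ℚ_) (sum-swap (f ∘ suc)))
  (sym (sum-+ (f zero) (λ j → sumℚ (λ i → f (suc i) j))))

sum-nonneg : {f : Fin n → ℚ} → (∀ i → 0ℚ ≤ℚ f i) → 0ℚ ≤ℚ sumℚ f
sum-nonneg {zero}  _  = ℚₚ.≤-refl
sum-nonneg {suc n} nn = ℚₚ.+-mono-≤ (nn zero) (sum-nonneg (nn ∘ suc))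

sum-++ : ∀ m (f : Fin (m + n) → ℚ) →
  sumℚ f ≡ sumℚ (λ i → f (i ↑ˡ n)) +ℚ sumℚ (λ j → f (m ↑ʳ j))
sum-++ zero    f = sym (ℚₚ.+-identityˡ (sumℚ f))
sum-++ (suc m) f = trans (cong (f zero +ℚ_) (sum-++ m (f ∘ suc)))
  (sym (ℚₚ.+-assoc (f zero) _ _))

sum-combine : ∀ m (f : Fin (m * n) → ℚ) →
  sumℚ f ≡ sumℚ (λ (i : Fin m) → sumℚ (λ (j : Fin n) → f (combine i j)))
sum-combine zero    f = refl
sum-combine {n} (suc m) f = trans (sum-++ n f)
  (cong (sumℚ (λ j → f (j ↑ˡ (m * n))) +ℚ_) (sum-combine m (λ j → f (n ↑ʳ j))))

lookup-ext : {x y : Vec ℚ N} → (∀ c → lookup x c ≡ lookup y c) → x ≡ y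
lookup-ext {x = x} {y} eq =
  trans (sym (tabulate∘lookup x)) (trans (tabulate-cong eq) (tabulate∘lookup y))

coord : (Fin k → Vec ℤ N) → Fin N → Fin k → ℚ
coord V c j = ℤ→ℚ (lookup (V j) c)

lookup-vsum : (f : Fin k → Vec ℚ N) (c : Fin N) →
  lookup (vsum f) c ≡ sumℚ (λ j → lookup (f j) c)
lookup-vsum {zero}  f c = lookup-replicate c 0ℚ
lookup-vsum {suc k} f c = trans (lookup-zipWith _+ℚ_ c (f zero) (vsum (f ∘ suc)))
  (cong (lookup (f zero) c +ℚ_) (lookup-vsum (f ∘ suc) c))

lookup-comb : (μ : Fin k → ℚ) (V : Fin k → Vec ℤ N) (c : Fin N) →
  lookup (vsum (λ j → μ j • toℚ^ (V j))) c ≡ sumℚ (λ j → μ j *ℚ coord V c j)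
lookup-comb μ V c = trans (lookup-vsum (λ j → μ j • toℚ^ (V j)) c) (sum-cong λ j →
  trans (lookup-map c (μ j *ℚ_) (toℚ^ (V j))) (cong (μ j *ℚ_) (lookup-map c ℤ→ℚ (V j))))

-- The superscript ᶜ marks vector equations read off coordinate by coordinate.
InDilateᶜ : (Fin k → Vec ℤ N) → ℕ → Vec ℤ N → Set
InDilateᶜ {k} V t x = Σ[ μ ∈ (Fin k → ℚ) ]
  ((∀ j → 0ℚ ≤ℚ μ j) × sumℚ μ ≡ ℕ→ℚ t ×
   (∀ c → sumℚ (λ j → μ j *ℚ coord V c j) ≡ ℤ→ℚ (lookup x c)))

AffRel : (Fin k → Vec ℤ N) → (Fin k → ℚ) → Set
AffRel V μ = sumℚ μ ≡ 0ℚ × (∀ c → sumℚ (λ j → μ j *ℚ coord V c j) ≡ 0ℚ)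

toᶜ : ∀ (V : Fin k → Vec ℤ N) t x → InDilate V t x → InDilateᶜ V t x
toᶜ V t x (μ , nn , s , e) = μ , nn , s , λ c →
  trans (sym (lookup-comb μ V c)) (trans (cong (λ v → lookup v c) e) (lookup-map c ℤ→ℚ x))

fromᶜ : ∀ (V : Fin k → Vec ℤ N) t x → InDilateᶜ V t x → InDilate V t x
fromᶜ V t x (μ , nn , s , e) = μ , nn , s , lookup-ext λ c →
  trans (lookup-comb μ V c) (trans (e c) (sym (lookup-map c ℤ→ℚ x)))

affIndep-elim : {V : Fin k → Vec ℤ N} → AffIndep (λ j → toℚ^ (V j)) →
  ∀ μ → AffRel V μ → ∀ j → μ j ≡ 0ℚ
affIndep-elim {V = V} ind μ (s , e) = ind μ s (lookup-ext λ c →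
  trans (lookup-comb μ V c) (trans (e c) (sym (lookup-replicate c 0ℚ))))

affIndep-intro : {V : Fin k → Vec ℤ N} → (∀ μ → AffRel V μ → ∀ j → μ j ≡ 0ℚ) →
  AffIndep (λ j → toℚ^ (V j))
affIndep-intro {V = V} f μ s e = f μ (s , λ c →
  trans (sym (lookup-comb μ V c)) (trans (cong (λ v → lookup v c) e) (lookup-replicate c 0ℚ)))

÷-inverse : ∀ p → p ≢ 0ℚ → Σ[ q ∈ ℚ ] q *ℚ p ≡ 1ℚ
÷-inverse p p≢0 = (1/ p) , ℚₚ.*-inverseˡ p
  where instance p-nonZero = ℚ.≢-nonZero p≢0

*-cancel-0 : ∀ {p q} → p ≢ 0ℚ → p *ℚ q ≡ 0ℚ → q ≡ 0ℚ
*-cancel-0 {p} {q} p≢0 eq with ÷-inverse p p≢0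
... | r , rp≡1 = begin
  q              ≡⟨ sym (ℚₚ.*-identityˡ q) ⟩
  1ℚ *ℚ q        ≡⟨ cong (_*ℚ q) (sym rp≡1) ⟩
  r *ℚ p *ℚ q    ≡⟨ ℚₚ.*-assoc r p q ⟩
  r *ℚ (p *ℚ q)  ≡⟨ cong (r *ℚ_) eq ⟩
  r *ℚ 0ℚ        ≡⟨ ℚₚ.*-zeroʳ r ⟩
  0ℚ             ∎
  where open ≡-Reasoning

-- Gaussian elimination by induction on the number of equations. If the first unknown occurs in no
-- equation, its unit vector is a solution. Otherwise a pivot row `p` clears that unknown from the
-- other rows, and a kernel vector `ν` of the reduced system `B` extends by back-substitution in row
-- `p`.
nontrivial-kernel : ∀ r (A : Fin r → Fin (suc r) → ℚ) →
  Σ[ μ ∈ (Fin (suc r) → ℚ) ] (∃ λ j → μ j ≢ 0ℚ) × (∀ i → sumℚ (λ j → μ j *ℚ A i j) ≡ 0ℚ)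
nontrivial-kernel zero    A = (λ _ → 1ℚ) , (zero , λ ()) , λ ()
nontrivial-kernel (suc r) A with Finₚ.all? (λ i → A i zero ℚₚ.≟ 0ℚ)
... | yes col₀ = μ , (zero , λ ()) , λ i → trans
    (cong₂ _+ℚ_ (trans (cong (1ℚ *ℚ_) (col₀ i)) (ℚₚ.*-zeroʳ 1ℚ))
      (sum-zero λ j → ℚₚ.*-zeroˡ (A i (suc j))))
    (ℚₚ.+-identityˡ 0ℚ)
  where
  μ : Fin (suc (suc r)) → ℚ
  μ zero    = 1ℚ
  μ (suc _) = 0ℚ
... | no ¬col₀ with Finₚ.¬∀⟶∃¬ (suc r) (λ i → A i zero ≡ 0ℚ) (λ i → A i zero ℚₚ.≟ 0ℚ) ¬col₀
...   | p , pivot≢0 with ÷-inverse (A p zero) pivot≢0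
...     | q , qpivot≡1 = μ , (suc j , νj≢0) , eqs
  where
  B : Fin r → Fin (suc r) → ℚ
  B i j = A (punchIn p i) (suc j) +ℚ -ℚ (A (punchIn p i) zero *ℚ q) *ℚ A p (suc j)

  rec = nontrivial-kernel r B
  ν = proj₁ rec
  j = proj₁ (proj₁ (proj₂ rec))
  νj≢0 = proj₂ (proj₁ (proj₂ rec))

  row : Fin (suc r) → ℚ
  row i = sumℚ (λ j → ν j *ℚ A i (suc j))

  μ : Fin (suc (suc r)) → ℚ
  μ zero    = -ℚ (q *ℚ row p)
  μ (suc j) = ν j

  row-elim : ∀ i → row (punchIn p i) +ℚ -ℚ (A (punchIn p i) zero *ℚ q) *ℚ row p ≡ 0ℚ
  row-elim i = trans (sym (trans
    (sum-cong λ j → solve 4 (λ v a b c → v :* (a :+ b :* c) := v :* a :+ b :* (v :* c)) refl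
      (ν j) (A (punchIn p i) (suc j)) b (A p (suc j)))
    (trans (sum-+ (λ j → ν j *ℚ A (punchIn p i) (suc j)) (λ j → b *ℚ (ν j *ℚ A p (suc j))))
      (cong (row (punchIn p i) +ℚ_) (sum-*ˡ b (λ j → ν j *ℚ A p (suc j)))))))
    (proj₂ (proj₂ rec) i)
    where b = -ℚ (A (punchIn p i) zero *ℚ q)

  eqs : ∀ i → μ zero *ℚ A i zero +ℚ row i ≡ 0ℚ
  eqs i with p Finₚ.≟ i
  ... | yes refl = trans
    (solve 3 (λ q a s → :- (q :* s) :* a :+ s := :- (q :* a) :* s :+ s) refl q (A p zero) (row p))
    (trans (cong (λ z → -ℚ z *ℚ row p +ℚ row p) qpivot≡1)
      (solve 1 (λ s → :- con 1ℚ :* s :+ s := con 0ℚ) refl (row p)))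
  ... | no p≢i = subst (λ i → μ zero *ℚ A i zero +ℚ row i ≡ 0ℚ) (Finₚ.punchIn-punchOut p≢i)
    (trans (solve 4 (λ q a s t → :- (q :* s) :* a :+ t := t :+ :- (a :* q) :* s) refl
        q (A (punchIn p (punchOut p≢i)) zero) (row p) (row (punchIn p (punchOut p≢i))))
      (row-elim (punchOut p≢i)))

-- Products

∀-splitAt : ∀ m {n} (P : Fin (m + n) → Set) →
  (∀ i → P (i ↑ˡ n)) → (∀ j → P (m ↑ʳ j)) → ∀ i → P i
∀-splitAt zero    P f g i       = g i
∀-splitAt (suc m) P f g zero    = f zero
∀-splitAt (suc m) P f g (suc i) = ∀-splitAt m (P ∘ suc) (f ∘ suc) g i

_⊗_ : (Fin k → Vec ℤ N) → (Fin l → Vec ℤ M) → Fin (k * l) → Vec ℤ (N + M)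
_⊗_ {k = k} {l = l} V U j = V (quotient l j) ++ U (remainder {k} l j)

module _ (V : Fin k → Vec ℤ N) (U : Fin l → Vec ℤ M) where

  ⊗-combine : ∀ i j → (V ⊗ U) (combine i j) ≡ V i ++ U j
  ⊗-combine i j = cong (λ p → V (proj₁ p) ++ U (proj₂ p)) (Finₚ.remQuot-combine i j)

  coord-⊗ˡ : ∀ c j → coord (V ⊗ U) (c ↑ˡ M) j ≡ coord V c (quotient l j)
  coord-⊗ˡ c j = cong ℤ→ℚ (lookup-++ˡ (V (quotient l j)) _ c)

  coord-⊗ʳ : ∀ c j → coord (V ⊗ U) (N ↑ʳ c) j ≡ coord U c (remainder {k} l j)
  coord-⊗ʳ c j = cong ℤ→ℚ (lookup-++ʳ (V (quotient l j)) _ c)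

  -- The first `N` coordinates see a weighting of the pairs only through its row sums. `comb-⊗ʳ` is
  -- the analogue for column sums, after exchanging the two summations.
  comb-⊗ˡ : ∀ (μ : Fin (k * l) → ℚ) c →
    sumℚ (λ j → μ j *ℚ coord (V ⊗ U) (c ↑ˡ M) j) ≡
    sumℚ (λ i → sumℚ (λ j → μ (combine i j)) *ℚ coord V c i)
  comb-⊗ˡ μ c = trans (sum-combine k _) (sum-cong λ i → trans
    (sum-cong λ j → cong (μ (combine i j) *ℚ_)
      (trans (coord-⊗ˡ c (combine i j)) (cong (coord V c ∘ proj₁) (Finₚ.remQuot-combine i j))))
    (sum-*ʳ (λ j → μ (combine i j)) (coord V c i)))

  comb-⊗ʳ : ∀ (μ : Fin (k * l) → ℚ) c →
    sumℚ (λ j → μ j *ℚ coord (V ⊗ U) (N ↑ʳ c) j) ≡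
    sumℚ (λ j → sumℚ (λ i → μ (combine {k} {l} i j)) *ℚ coord U c j)
  comb-⊗ʳ μ c = trans (sum-combine k _) (trans (sum-swap {k} {l} _) (sum-cong λ j → trans
    (sum-cong λ i → cong (μ (combine i j) *ℚ_)
      (trans (coord-⊗ʳ c (combine i j))
        (cong (coord U c ∘ proj₂) (Finₚ.remQuot-combine {k} {l} i j))))
    (sum-*ʳ (λ i → μ (combine {k} {l} i j)) (coord U c j))))

  -- The two marginals of a weighting of the pairs keep its total mass `t`; the row sums represent
  -- `x` and the column sums `y`.
  inDilate-⊗⁻ : ∀ t x y → InDilate (V ⊗ U) t (x ++ y) → InDilate V t x × InDilate U t y
  inDilate-⊗⁻ t x y p with toᶜ (V ⊗ U) t (x ++ y) p
  ... | μ , nn , s , e =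
    fromᶜ V t x ((λ i → sumℚ (λ j → μ (combine i j))) , (λ i → sum-nonneg (λ j → nn (combine i j))) ,
      trans (sym (sum-combine k μ)) s ,
      λ c → trans (sym (comb-⊗ˡ μ c)) (trans (e (c ↑ˡ M)) (cong ℤ→ℚ (lookup-++ˡ x y c)))) ,
    fromᶜ U t y ((λ j → sumℚ (λ i → μ (combine {k} {l} i j))) ,
      (λ j → sum-nonneg (λ i → nn (combine {k} {l} i j))) ,
      trans (sym (trans (sum-combine k μ) (sum-swap {k} {l} (λ i j → μ (combine i j))))) s ,
      λ c → trans (sym (comb-⊗ʳ μ c)) (trans (e (N ↑ʳ c)) (cong ℤ→ℚ (lookup-++ʳ x y c))))

*-nonneg : ∀ {p q} → 0ℚ ≤ℚ p → 0ℚ ≤ℚ q → 0ℚ ≤ℚ p *ℚ q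
*-nonneg {p} {q} 0≤p 0≤q = ℚₚ.nonNegative⁻¹ (p *ℚ q) {{ℚₚ.nonNeg*nonNeg⇒nonNeg p q}}
  where instance
    p-nonNeg = ℚ.nonNegative 0≤p
    q-nonNeg = ℚ.nonNegative 0≤q

cancel-reciprocal : ∀ s t a → s *ℚ t ≡ 1ℚ → s *ℚ a *ℚ t ≡ a
cancel-reciprocal s t a st≡1 =
  trans (solve 3 (λ s a t → s :* a :* t := s :* t :* a) refl s a t)
    (trans (cong (_*ℚ a) st≡1) (ℚₚ.*-identityˡ a))

-- The reciprocal s of t normalises the product of two weightings of total mass t.
product-weights : (V : Fin k → Vec ℤ N) (U : Fin l → Vec ℤ M) (t : ℕ) (s : ℚ) →
  0ℚ ≤ℚ s → s *ℚ ℕ→ℚ t ≡ 1ℚ → ∀ x y →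
  InDilate V t x → InDilate U t y → InDilate (V ⊗ U) t (x ++ y)
product-weights {k} {N} {l} {M} V U t s 0≤s st≡1 x y p q with toᶜ V t x p | toᶜ U t y q
... | α , αnn , αs , αe | β , βnn , βs , βe = fromᶜ (V ⊗ U) t (x ++ y)
  ( ω
  , (λ j → *-nonneg 0≤s (*-nonneg (αnn (quotient l j)) (βnn (remainder {k} l j))))
  , trans (sum-combine k ω) (trans (sum-cong ω-row) αs)
  , ∀-splitAt N _
    (λ c → trans (comb-⊗ˡ V U ω c) (trans
      (sum-cong λ i → cong (_*ℚ coord V c i) (ω-row i))
      (trans (αe c) (cong ℤ→ℚ (sym (lookup-++ˡ x y c))))))
    (λ c → trans (comb-⊗ʳ V U ω c) (trans
      (sum-cong λ j → cong (_*ℚ coord U c j) (ω-col j))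
      (trans (βe c) (cong ℤ→ℚ (sym (lookup-++ʳ x y c)))))) )
  where
  weight : Fin k × Fin l → ℚ
  weight (i , j) = s *ℚ (α i *ℚ β j)

  ω : Fin (k * l) → ℚ
  ω = weight ∘ remQuot l

  ω-combine : ∀ i j → ω (combine i j) ≡ s *ℚ (α i *ℚ β j)
  ω-combine i j = cong weight (Finₚ.remQuot-combine i j)

  ω-row : ∀ i → sumℚ (λ j → ω (combine i j)) ≡ α i
  ω-row i = trans (sum-cong λ j → trans (ω-combine i j) (sym (ℚₚ.*-assoc s (α i) (β j))))
    (trans (sum-*ˡ (s *ℚ α i) β) (trans (cong (s *ℚ α i *ℚ_) βs) (cancel-reciprocal s (ℕ→ℚ t) (α i) st≡1)))

  ω-col : ∀ j → sumℚ (λ i → ω (combine {k} {l} i j)) ≡ β j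
  ω-col j = trans (sum-cong λ i → trans (ω-combine i j)
      (solve 3 (λ s a b → s :* (a :* b) := s :* b :* a) refl s (α i) (β j)))
    (trans (sum-*ˡ (s *ℚ β j) α) (trans (cong (s *ℚ β j *ℚ_) αs) (cancel-reciprocal s (ℕ→ℚ t) (β j) st≡1)))

length-cartesianProductWith : ∀ {A B C : Set} (f : A → B → C) xs ys →
  length (cartesianProductWith f xs ys) ≡ length xs * length ys
length-cartesianProductWith f List.[]       ys = refl
length-cartesianProductWith f (x List.∷ xs) ys =
  trans (length-++ (List.map (f x) ys))
    (cong₂ _+_ (length-map (f x) ys) (length-cartesianProductWith f xs ys))

latticeCount-⊗ : ∀ (V : Fin k → Vec ℤ N) (U : Fin l → Vec ℤ M) t s {a b} →
  0ℚ ≤ℚ s → s *ℚ ℕ→ℚ t ≡ 1ℚ →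
  LatticeCount V t a → LatticeCount U t b → LatticeCount (V ⊗ U) t (a * b)
latticeCount-⊗ {N = N} V U t s 0≤s st≡1 (L , L! , Lmem , refl) (K , K! , Kmem , refl) =
  cartesianProductWith _++_ L K ,
  Uniqueₚ.cartesianProductWith⁺ _++_ (++-injective _ _) L! K! ,
  (λ z → (λ z∈ → sound (∈-cartesianProductWith⁻ _++_ L K z∈)) , complete (Vec.splitAt N z)) ,
  length-cartesianProductWith _++_ L K
  where
  sound : ∀ {z} → ∃ (λ x → ∃ λ y → x ∈ L × y ∈ K × z ≡ x ++ y) → InDilate (V ⊗ U) t z
  sound (x , y , x∈ , y∈ , refl) =
    product-weights V U t s 0≤s st≡1 x y (proj₁ (Lmem x) x∈) (proj₁ (Kmem y) y∈)

  complete : ∀ {z} → (Σ[ x ∈ Vec ℤ _ ] Σ[ y ∈ Vec ℤ _ ] z ≡ x ++ y) →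
    InDilate (V ⊗ U) t z → z ∈ cartesianProductWith _++_ L K
  complete (x , y , refl) p = ∈-cartesianProductWith⁺ _++_
    (proj₂ (Lmem x) (proj₁ (inDilate-⊗⁻ V U t x y p))) (proj₂ (Kmem y) (proj₂ (inDilate-⊗⁻ V U t x y p)))

-- Dimension of a product

-- While a contradiction is being derived, finitely many doubly negated facts may be assumed all at
-- once. This is how one representation per chosen vertex is obtained in `⊗-dependent`.
¬¬-Fin : ∀ n {P : Fin n → Set} → (∀ i → ¬ ¬ P i) → ¬ ¬ (∀ i → P i)
¬¬-Fin zero    _ ¬all = ¬all λ ()
¬¬-Fin (suc n) f ¬all = f zero λ p₀ → ¬¬-Fin n (f ∘ suc) λ ps →
  ¬all λ { zero → p₀ ; (suc i) → ps i }

AffComb : (Fin k → Vec ℤ N) → Vec ℤ N → Set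
AffComb {k} V x = Σ[ μ ∈ (Fin k → ℚ) ]
  (sumℚ μ ≡ 1ℚ × (∀ c → sumℚ (λ j → μ j *ℚ coord V c j) ≡ ℤ→ℚ (lookup x c)))

-- A maximal independent family becomes dependent when `V j` joins it. In a nontrivial relation the
-- weight of `V j` cannot vanish, as the rest would be a relation within the family; dividing by it
-- expresses `V j`. The double negation stays because `HasDim` denies independence without
-- exhibiting a relation.
¬¬affComb : (V : Fin k → Vec ℤ N) (ι : Fin m → Fin k) →
  AffIndep (λ i → toℚ^ (V (ι i))) →
  ((κ : Fin (suc m) → Fin k) → ¬ AffIndep (λ i → toℚ^ (V (κ i)))) →
  ∀ j → ¬ ¬ AffComb (V ∘ ι) (V j)
¬¬affComb {k} {N} {m} V ι indep dep j ¬comb =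
  dep κ (affIndep-intro {V = V ∘ κ} λ μ rel i →
    decidable-stable (μ i ℚₚ.≟ 0ℚ) λ μi≢0 → refute μ rel i μi≢0)
  where
  κ : Fin (suc m) → Fin k
  κ zero    = j
  κ (suc i) = ι i

  refute : ∀ μ → AffRel (V ∘ κ) μ → ∀ i → ¬ (μ i ≢ 0ℚ)
  refute μ (s , e) i μi≢0 with μ zero ℚₚ.≟ 0ℚ
  refute μ (s , e) zero μi≢0 | yes μ₀≡0 = μi≢0 μ₀≡0
  refute μ (s , e) (suc i) μi≢0 | yes μ₀≡0 = μi≢0 (affIndep-elim {V = V ∘ ι} indep (μ ∘ suc)
    ( trans (sym (drop₀ (sumℚ (μ ∘ suc)) μ₀≡0)) s
    , λ c → trans (sym (drop₀ _ (trans (cong (_*ℚ coord V c j) μ₀≡0) (ℚₚ.*-zeroˡ (coord V c j))))) (e c)) i)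
    where
    drop₀ : ∀ {p} q → p ≡ 0ℚ → p +ℚ q ≡ q
    drop₀ q refl = ℚₚ.+-identityˡ q
  ... | no μ₀≢0 with ÷-inverse (μ zero) μ₀≢0
  ...   | r , rμ₀≡1 = ¬comb ((λ i → -ℚ r *ℚ μ (suc i)) ,
    trans (sum-*ˡ (-ℚ r) (μ ∘ suc))
      (solve-for 1ℚ (trans (cong (_+ℚ sumℚ (μ ∘ suc)) (ℚₚ.*-identityʳ (μ zero))) s)) ,
    λ c → trans (sum-cong λ i → ℚₚ.*-assoc (-ℚ r) (μ (suc i)) (coord V c (ι i)))
      (trans (sum-*ˡ (-ℚ r) (λ i → μ (suc i) *ℚ coord V c (ι i))) (solve-for _ (e c))))
    where
    -- One rearrangement serves the total weight, with `v` equal to 1, and every coordinate of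
    -- `V j`.
    solve-for : ∀ v {S} → μ zero *ℚ v +ℚ S ≡ 0ℚ → -ℚ r *ℚ S ≡ v
    solve-for v {S} eq = begin
      -ℚ r *ℚ S
        ≡⟨ solve 4 (λ r S m v → :- r :* S := r :* m :* v :+ :- r :* (m :* v :+ S)) refl r S (μ zero) v ⟩
      r *ℚ μ zero *ℚ v +ℚ -ℚ r *ℚ (μ zero *ℚ v +ℚ S)
        ≡⟨ cong₂ (λ a b → a *ℚ v +ℚ -ℚ r *ℚ b) rμ₀≡1 eq ⟩
      1ℚ *ℚ v +ℚ -ℚ r *ℚ 0ℚ
        ≡⟨ solve 2 (λ r v → con 1ℚ :* v :+ :- r :* con 0ℚ := v) refl r v ⟩
      v ∎
      where open ≡-Reasoning

-- Σ μᵢ (1, vᵢ, uᵢ) vanishes as soon as its d+1 coordinates in the affine basis of the first factor and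
-- its M coordinates in the second one do, and that is a linear system with d+1+M equations.
⊗-dependent : (V : Fin k → Vec ℤ N) (U : Fin l → Vec ℤ M) → HasDim V d →
  (ι : Fin (suc (suc d + M)) → Fin (k * l)) → ¬ AffIndep (λ i → toℚ^ ((V ⊗ U) (ι i)))
⊗-dependent {k} {N} {l} {M} {d} V U ((b , indep) , dep) ι ι-indep =
  ¬¬-Fin (suc (suc d + M)) (λ i → ¬¬affComb V b indep dep (quotient l (ι i))) λ combs →
  let
    a : Fin (suc (suc d + M)) → Fin (suc d) → ℚ
    a i = proj₁ (combs i)

    entry : Fin (suc (suc d + M)) → Fin (suc d) ⊎ Fin M → ℚ
    entry i = [ a i , (λ c → coord U c (remainder {k} l (ι i))) ]

    A : Fin (suc d + M) → Fin (suc (suc d + M)) → ℚ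
    A r i = entry i (splitAt (suc d) r)

    kernel = nontrivial-kernel (suc d + M) A
    μ = proj₁ kernel
    j = proj₁ (proj₁ (proj₂ kernel))

    basis-eqs : ∀ r → sumℚ (λ i → μ i *ℚ a i r) ≡ 0ℚ
    basis-eqs r = trans (sum-cong λ i → cong (λ s → μ i *ℚ entry i s)
      (sym (Finₚ.splitAt-↑ˡ (suc d) r M))) (proj₂ (proj₂ kernel) (r ↑ˡ M))

    U-eqs : ∀ c → sumℚ (λ i → μ i *ℚ coord U c (remainder {k} l (ι i))) ≡ 0ℚ
    U-eqs c = trans (sum-cong λ i → cong (λ s → μ i *ℚ entry i s)
      (sym (Finₚ.splitAt-↑ʳ (suc d) M c))) (proj₂ (proj₂ kernel) (suc d ↑ʳ c))

    -- An affine function with values `f` on the basis takes the value `Σ a i r * f r` at the `i`-th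
    -- point, so `basis-eqs` annihilates it. It is applied to the constant 1 and to each coordinate
    -- of the first factor.
    through-basis : ∀ (f : Fin (suc d) → ℚ) (g : Fin (suc (suc d + M)) → ℚ) →
      (∀ i → sumℚ (λ r → a i r *ℚ f r) ≡ g i) → sumℚ (λ i → μ i *ℚ g i) ≡ 0ℚ
    through-basis f g eq = trans
      (sum-cong λ i → trans (cong (μ i *ℚ_) (sym (eq i)))
        (trans (sym (sum-*ˡ (μ i) (λ r → a i r *ℚ f r)))
          (sum-cong λ r → sym (ℚₚ.*-assoc (μ i) (a i r) (f r)))))
      (trans (sum-swap (λ i r → μ i *ℚ a i r *ℚ f r)) (sum-zero λ r → trans
        (sum-*ʳ (λ i → μ i *ℚ a i r) (f r))
        (trans (cong (_*ℚ f r) (basis-eqs r)) (ℚₚ.*-zeroˡ (f r)))))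
  in
  proj₂ (proj₁ (proj₂ kernel)) (affIndep-elim {V = (V ⊗ U) ∘ ι} ι-indep μ
    ( trans (sum-cong λ i → sym (ℚₚ.*-identityʳ (μ i))) (through-basis (λ _ → 1ℚ) (λ _ → 1ℚ)
        λ i → trans (sum-cong λ r → ℚₚ.*-identityʳ (a i r)) (proj₁ (proj₂ (combs i))))
    , ∀-splitAt N _
      (λ c → trans (sum-cong λ i → cong (μ i *ℚ_) (coord-⊗ˡ V U c (ι i)))
        (through-basis (coord (V ∘ b) c) (λ i → coord V c (quotient l (ι i)))
          λ i → proj₂ (proj₂ (combs i)) c))
      (λ c → trans (sum-cong λ i → cong (μ i *ℚ_) (coord-⊗ʳ V U c (ι i))) (U-eqs c)) ) j)

-- The points are (bᵢ, κ₀) for all i together with (b₀, κⱼ) for j ≥ 1. Projecting a relation to the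
-- second factor merges the former into the single point κ₀ with weight `sumℚ α`, so independence of
-- `κ` forces every `γ j` and also `sumℚ α` to vanish. What remains is a relation among the bᵢ.
⊗-independent : ∀ {e} (V : Fin k → Vec ℤ N) (U : Fin l → Vec ℤ M)
  (b : Fin (suc d) → Fin k) (κ : Fin (suc e) → Fin l) →
  AffIndep (λ i → toℚ^ (V (b i))) → AffIndep (λ i → toℚ^ (U (κ i))) →
  Σ[ ι ∈ (Fin (suc d + e) → Fin (k * l)) ] AffIndep (λ i → toℚ^ ((V ⊗ U) (ι i)))
⊗-independent {k} {N} {l} {M} {d} {e} V U b κ b-indep κ-indep =
  ι , affIndep-intro {V = (V ⊗ U) ∘ ι} λ μ rel → ∀-splitAt (suc d) (λ i → μ i ≡ 0ℚ)
    (λ i → left μ rel i) (λ j → right μ rel (suc j))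
  where
  pick : Fin (suc d) ⊎ Fin e → Fin (k * l)
  pick (inj₁ i) = combine (b i) (κ zero)
  pick (inj₂ j) = combine (b zero) (κ (suc j))

  ι : Fin (suc d + e) → Fin (k * l)
  ι i = pick (splitAt (suc d) i)

  module _ (μ : Fin (suc d + e) → ℚ) (rel : AffRel ((V ⊗ U) ∘ ι) μ) where
    α : Fin (suc d) → ℚ
    α i = μ (i ↑ˡ e)

    γ : Fin e → ℚ
    γ j = μ (suc d ↑ʳ j)

    β : Fin (suc e) → ℚ
    β zero    = sumℚ α
    β (suc j) = γ j

    at-left : ∀ i → (V ⊗ U) (ι (i ↑ˡ e)) ≡ V (b i) ++ U (κ zero)
    at-left i = trans (cong ((V ⊗ U) ∘ pick) (Finₚ.splitAt-↑ˡ (suc d) i e)) (⊗-combine V U _ _)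

    at-right : ∀ j → (V ⊗ U) (ι (suc d ↑ʳ j)) ≡ V (b zero) ++ U (κ (suc j))
    at-right j = trans (cong ((V ⊗ U) ∘ pick) (Finₚ.splitAt-↑ʳ (suc d) e j)) (⊗-combine V U _ _)

    β-sum : sumℚ α +ℚ sumℚ γ ≡ 0ℚ
    β-sum = trans (sym (sum-++ (suc d) μ)) (proj₁ rel)

    right : ∀ j → β j ≡ 0ℚ
    right = affIndep-elim {V = U ∘ κ} κ-indep β (β-sum , λ c → trans
      (cong (_+ℚ sumℚ (λ j → γ j *ℚ coord U c (κ (suc j)))) (sym (sum-*ʳ α (coord U c (κ zero)))))
      (trans (sym (trans (sum-++ (suc d) (λ i → μ i *ℚ coord ((V ⊗ U) ∘ ι) (N ↑ʳ c) i)) (cong₂ _+ℚ_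
        (sum-cong λ i → cong (λ v → α i *ℚ ℤ→ℚ v)
          (trans (cong (λ v → lookup v (N ↑ʳ c)) (at-left i)) (lookup-++ʳ (V (b i)) _ c)))
        (sum-cong λ j → cong (λ v → γ j *ℚ ℤ→ℚ v)
          (trans (cong (λ v → lookup v (N ↑ʳ c)) (at-right j)) (lookup-++ʳ (V (b zero)) _ c))))))
        (proj₂ rel (N ↑ʳ c))))

    left : ∀ i → α i ≡ 0ℚ
    -- `right zero` is the statement that the weights `α` sum to 0.
    left = affIndep-elim {V = V ∘ b} b-indep α (right zero , λ c → trans
      (sym (ℚₚ.+-identityʳ _)) (trans (cong (sumℚ (λ i → α i *ℚ coord V c (b i)) +ℚ_)
        (sym (sum-zero λ j → trans (cong (_*ℚ coord V c (b zero)) (right (suc j)))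
          (ℚₚ.*-zeroˡ (coord V c (b zero))))))
      (trans (sym (trans (sum-++ (suc d) (λ i → μ i *ℚ coord ((V ⊗ U) ∘ ι) (c ↑ˡ M) i)) (cong₂ _+ℚ_
        (sum-cong λ i → cong (λ v → α i *ℚ ℤ→ℚ v)
          (trans (cong (λ v → lookup v (c ↑ˡ M)) (at-left i)) (lookup-++ˡ (V (b i)) _ c)))
        (sum-cong λ j → cong (λ v → γ j *ℚ ℤ→ℚ v)
          (trans (cong (λ v → lookup v (c ↑ˡ M)) (at-right j)) (lookup-++ˡ (V (b zero)) _ c))))))
        (proj₂ rel (c ↑ˡ M)))))

-- The second factor spans its ambient space, so its `M` coordinates already count its dimension and
-- the two bounds meet at `d + M`.
hasDim-⊗ : (V : Fin k → Vec ℤ N) (U : Fin l → Vec ℤ M) (κ : Fin (suc M) → Fin l) →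
  AffIndep (λ i → toℚ^ (U (κ i))) → HasDim V d → HasDim (V ⊗ U) (d + M)
hasDim-⊗ V U κ κ-indep dimV@((b , b-indep) , _) =
  ⊗-independent V U b κ b-indep κ-indep , ⊗-dependent V U dimV

-- Lattice points of the parallelogram

ℤ→ℚᵘ : ∀ i → ℚ.toℚᵘ (ℤ→ℚ i) ℚᵘ.≃ mkℚᵘ i 0
ℤ→ℚᵘ i = ℚₚ.toℚᵘ-fromℚᵘ (mkℚᵘ i 0)

ℤ→ℚ-+ : ∀ i j → ℤ→ℚ (i ℤ.+ j) ≡ ℤ→ℚ i +ℚ ℤ→ℚ j
ℤ→ℚ-+ i j = ℚₚ.toℚᵘ-injective (begin
  ℚ.toℚᵘ (ℤ→ℚ (i ℤ.+ j))                     ≈⟨ ℤ→ℚᵘ (i ℤ.+ j) ⟩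
  mkℚᵘ (i ℤ.+ j) 0                           ≈⟨ *≡* (cong (ℤ._* + 1)
    (sym (cong₂ ℤ._+_ (ℤₚ.*-identityʳ i) (ℤₚ.*-identityʳ j)))) ⟩
  mkℚᵘ i 0 ℚᵘ.+ mkℚᵘ j 0                     ≈⟨ ℚᵘₚ.+-cong (ℚᵘₚ.≃-sym (ℤ→ℚᵘ i)) (ℚᵘₚ.≃-sym (ℤ→ℚᵘ j)) ⟩
  ℚ.toℚᵘ (ℤ→ℚ i) ℚᵘ.+ ℚ.toℚᵘ (ℤ→ℚ j)       ≈⟨ ℚᵘₚ.≃-sym (ℚₚ.toℚᵘ-homo-+ (ℤ→ℚ i) (ℤ→ℚ j)) ⟩
  ℚ.toℚᵘ (ℤ→ℚ i +ℚ ℤ→ℚ j)                  ∎)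
  where open ℚᵘₚ.≃-Reasoning

ℤ→ℚ-* : ∀ i j → ℤ→ℚ (i ℤ.* j) ≡ ℤ→ℚ i *ℚ ℤ→ℚ j
ℤ→ℚ-* i j = ℚₚ.toℚᵘ-injective (begin
  ℚ.toℚᵘ (ℤ→ℚ (i ℤ.* j))                     ≈⟨ ℤ→ℚᵘ (i ℤ.* j) ⟩
  mkℚᵘ i 0 ℚᵘ.* mkℚᵘ j 0                     ≈⟨ ℚᵘₚ.*-cong (ℚᵘₚ.≃-sym (ℤ→ℚᵘ i)) (ℚᵘₚ.≃-sym (ℤ→ℚᵘ j)) ⟩
  ℚ.toℚᵘ (ℤ→ℚ i) ℚᵘ.* ℚ.toℚᵘ (ℤ→ℚ j)       ≈⟨ ℚᵘₚ.≃-sym (ℚₚ.toℚᵘ-homo-* (ℤ→ℚ i) (ℤ→ℚ j)) ⟩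
  ℚ.toℚᵘ (ℤ→ℚ i *ℚ ℤ→ℚ j)                  ∎)
  where open ℚᵘₚ.≃-Reasoning

ℕ→ℚ-+ : ∀ a b → ℕ→ℚ (a + b) ≡ ℕ→ℚ a +ℚ ℕ→ℚ b
ℕ→ℚ-+ a b = ℤ→ℚ-+ (+ a) (+ b)

ℕ→ℚ-* : ∀ a b → ℕ→ℚ (a * b) ≡ ℕ→ℚ a *ℚ ℕ→ℚ b
ℕ→ℚ-* a b = trans (cong ℤ→ℚ (ℤₚ.pos-* a b)) (ℤ→ℚ-* (+ a) (+ b))

ℤ→ℚ-mono-≤ : ∀ i j → i ℤ.≤ j → ℤ→ℚ i ≤ℚ ℤ→ℚ j
ℤ→ℚ-mono-≤ i j i≤j = ℚₚ.toℚᵘ-cancel-≤ (begin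
  ℚ.toℚᵘ (ℤ→ℚ i)  ≃⟨ ℤ→ℚᵘ i ⟩
  mkℚᵘ i 0        ≤⟨ *≤* (ℤₚ.*-monoʳ-≤-nonNeg (+ 1) i≤j) ⟩
  mkℚᵘ j 0        ≃⟨ ℚᵘₚ.≃-sym (ℤ→ℚᵘ j) ⟩
  ℚ.toℚᵘ (ℤ→ℚ j)  ∎)
  where open ℚᵘₚ.≤-Reasoning

ℤ→ℚ-cancel-≤ : ∀ i j → ℤ→ℚ i ≤ℚ ℤ→ℚ j → i ℤ.≤ j
ℤ→ℚ-cancel-≤ i j p = ℤₚ.*-cancelʳ-≤-pos i j (+ 1) (ℚᵘₚ.drop-*≤* (begin
  mkℚᵘ i 0        ≃⟨ ℚᵘₚ.≃-sym (ℤ→ℚᵘ i) ⟩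
  ℚ.toℚᵘ (ℤ→ℚ i)  ≤⟨ ℚₚ.toℚᵘ-mono-≤ p ⟩
  ℚ.toℚᵘ (ℤ→ℚ j)  ≃⟨ ℤ→ℚᵘ j ⟩
  mkℚᵘ j 0        ∎))
  where open ℚᵘₚ.≤-Reasoning

ℕ→ℚ-nonneg : ∀ a → 0ℚ ≤ℚ ℕ→ℚ a
ℕ→ℚ-nonneg a = ℤ→ℚ-mono-≤ (+ 0) (+ a) (ℤ.+≤+ z≤n)

reciprocal : ∀ t → 1 ≤ t → Σ[ s ∈ ℚ ] (0ℚ ≤ℚ s × s *ℚ ℕ→ℚ t ≡ 1ℚ)
reciprocal (suc t) _ = (1/ p) , ℚₚ.<⇒≤ (ℚₚ.positive⁻¹ (1/ p) {{ℚₚ.1/pos⇒pos p}}) , ℚₚ.*-inverseˡ p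
  where
  p = ℕ→ℚ (suc t)
  instance
    p-pos : ℚ.Positive p
    p-pos = ℚₚ.normalize-pos (suc t) 1
    p-nonZero : ℚ.NonZero p
    p-nonZero = ℚₚ.pos⇒nonZero p

parallelogram : ℕ → Fin 4 → Vec ℤ 2
parallelogram n zero                   = + 0 ∷ + 0 ∷ []
parallelogram n (suc zero)             = + 1 ∷ + 0 ∷ []
parallelogram n (suc (suc zero))       = + 1 ∷ + n ∷ []
parallelogram n (suc (suc (suc zero))) = + 2 ∷ + n ∷ []

2ℚ : ℚ
2ℚ = ℕ→ℚ 2

p≤p+q : ∀ p {q r} → 0ℚ ≤ℚ q → r ≡ p +ℚ q → p ≤ℚ r
p≤p+q p {q} 0≤q refl = subst (_≤ℚ p +ℚ q) (ℚₚ.+-identityʳ p) (ℚₚ.+-monoʳ-≤ p 0≤q)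

+-nonneg : ∀ {p q} → 0ℚ ≤ℚ p → 0ℚ ≤ℚ q → 0ℚ ≤ℚ p +ℚ q
+-nonneg {p} {q} = ℚₚ.+-mono-≤ {0ℚ} {p} {0ℚ} {q}

-- The dilated parallelogram as a system of inequalities

module _ (n : ℚ) (0≤n : 0ℚ ≤ℚ n) where

  -- For the point α(1,0) + β(1,n) one has nβ = y and nα = nx - y. The fields say 0 ≤ β ≤ t and 0 ≤
  -- α ≤ t, cleared of the denominator n.
  record Inequalities (t x y : ℚ) : Set where
    constructor ineqs
    field
      0≤y   : 0ℚ ≤ℚ y
      y≤nt  : y ≤ℚ n *ℚ t
      y≤nx  : y ≤ℚ n *ℚ x
      nx≤   : n *ℚ x ≤ℚ y +ℚ n *ℚ t

  -- The weights belong to (0,0), (1,0), (1,n), (2,n) in this order. The equations have exactly the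
  -- shape to which `sumℚ` over four vertices reduces, trailing zeros included, so they pass to and
  -- from `InDilateᶜ` by computation alone.
  record Weights (t x y : ℚ) : Set where
    constructor weights
    field
      {a b c f} : ℚ
      0≤a : 0ℚ ≤ℚ a
      0≤b : 0ℚ ≤ℚ b
      0≤c : 0ℚ ≤ℚ c
      0≤f : 0ℚ ≤ℚ f
      sum-t : a +ℚ (b +ℚ (c +ℚ (f +ℚ 0ℚ))) ≡ t
      sum-x : a *ℚ 0ℚ +ℚ (b *ℚ 1ℚ +ℚ (c *ℚ 1ℚ +ℚ (f *ℚ 2ℚ +ℚ 0ℚ))) ≡ x
      sum-y : a *ℚ 0ℚ +ℚ (b *ℚ 0ℚ +ℚ (c *ℚ n +ℚ (f *ℚ n +ℚ 0ℚ))) ≡ y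

  -- Each inequality belongs to one edge, and its slack is `n` times the total weight of the two
  -- vertices off that edge.
  weights⇒ineqs : ∀ {t x y} → Weights t x y → Inequalities t x y
  weights⇒ineqs (weights {a} {b} {c} {f} 0≤a 0≤b 0≤c 0≤f refl refl refl) = ineqs
    (subst (0ℚ ≤ℚ_) (solve 5 (λ n a b c e →
        n :* (c :+ e) := a :* con 0ℚ :+ (b :* con 0ℚ :+ (c :* n :+ (e :* n :+ con 0ℚ)))) refl n a b c f)
      (*-nonneg 0≤n (+-nonneg 0≤c 0≤f)))
    (p≤p+q _ (*-nonneg 0≤n (+-nonneg 0≤a 0≤b)) (solve 5 (λ n a b c e →
        n :* (a :+ (b :+ (c :+ (e :+ con 0ℚ)))) :=
        (a :* con 0ℚ :+ (b :* con 0ℚ :+ (c :* n :+ (e :* n :+ con 0ℚ)))) :+ n :* (a :+ b)) refl n a b c f))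
    (p≤p+q _ (*-nonneg 0≤n (+-nonneg 0≤b 0≤f)) (solve 5 (λ n a b c e →
        n :* (a :* con 0ℚ :+ (b :* con 1ℚ :+ (c :* con 1ℚ :+ (e :* con 2ℚ :+ con 0ℚ)))) :=
        (a :* con 0ℚ :+ (b :* con 0ℚ :+ (c :* n :+ (e :* n :+ con 0ℚ)))) :+ n :* (b :+ e)) refl n a b c f))
    (p≤p+q _ (*-nonneg 0≤n (+-nonneg 0≤a 0≤c)) (solve 5 (λ n a b c e →
        (a :* con 0ℚ :+ (b :* con 0ℚ :+ (c :* n :+ (e :* n :+ con 0ℚ)))) :+ n :* (a :+ (b :+ (c :+ (e :+ con 0ℚ)))) :=
        n :* (a :* con 0ℚ :+ (b :* con 1ℚ :+ (c :* con 1ℚ :+ (e :* con 2ℚ :+ con 0ℚ)))) :+ n :* (a :+ c)) refl n a b c f))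

  0≤q-p : ∀ {p q} → p ≤ℚ q → 0ℚ ≤ℚ q +ℚ -ℚ p
  0≤q-p {p} {q} p≤q = subst (_≤ℚ q +ℚ -ℚ p) (ℚₚ.+-inverseʳ p) (ℚₚ.+-monoˡ-≤ (-ℚ p) p≤q)

  -- The point is α(1,0) + β(1,n) with α, β ∈ [0,t], and the weights are those of (α,β)
  -- in the square [0,t]², namely the bilinear ones.
  ineqs⇒weights : ∀ {s r} t x y → 0ℚ ≤ℚ s → 0ℚ ≤ℚ r → s *ℚ t ≡ 1ℚ → r *ℚ n ≡ 1ℚ →
    Inequalities t x y → Weights t x y
  ineqs⇒weights {s} {r} t x y 0≤s 0≤r st≡1 rn≡1 (ineqs 0≤y y≤nt y≤nx nx≤) = weights
    {a = q *ℚ (x₁ *ℚ y₁)} {q *ℚ (x₀ *ℚ y₁)} {q *ℚ (x₁ *ℚ y)} {q *ℚ (x₀ *ℚ y)}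
    (*-nonneg 0≤q (*-nonneg (0≤q-p nx≤) (0≤q-p y≤nt)))
    (*-nonneg 0≤q (*-nonneg (0≤q-p y≤nx) (0≤q-p y≤nt)))
    (*-nonneg 0≤q (*-nonneg (0≤q-p nx≤) 0≤y))
    (*-nonneg 0≤q (*-nonneg (0≤q-p y≤nx) 0≤y))
    (trans (solve 6 (λ s r n t x y →
        let q = s :* (r :* r) ; x₀ = n :* x :+ :- y ; x₁ = y :+ n :* t :+ :- (n :* x) ; y₁ = n :* t :+ :- y in
        q :* (x₁ :* y₁) :+ (q :* (x₀ :* y₁) :+ (q :* (x₁ :* y) :+ (q :* (x₀ :* y) :+ con 0ℚ)))
          := (s :* t) :* ((r :* n) :* (r :* n)) :* t) refl s r n t x y)
      (units t))
    (trans (solve 6 (λ s r n t x y →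
        let q = s :* (r :* r) ; x₀ = n :* x :+ :- y ; x₁ = y :+ n :* t :+ :- (n :* x) ; y₁ = n :* t :+ :- y in
        q :* (x₁ :* y₁) :* con 0ℚ :+ (q :* (x₀ :* y₁) :* con 1ℚ :+
          (q :* (x₁ :* y) :* con 1ℚ :+ (q :* (x₀ :* y) :* con 2ℚ :+ con 0ℚ)))
          := (s :* t) :* ((r :* n) :* (r :* n)) :* x) refl s r n t x y)
      (units x))
    (trans (solve 6 (λ s r n t x y →
        let q = s :* (r :* r) ; x₀ = n :* x :+ :- y ; x₁ = y :+ n :* t :+ :- (n :* x) ; y₁ = n :* t :+ :- y in
        q :* (x₁ :* y₁) :* con 0ℚ :+ (q :* (x₀ :* y₁) :* con 0ℚ :+
          (q :* (x₁ :* y) :* n :+ (q :* (x₀ :* y) :* n :+ con 0ℚ)))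
          := (s :* t) :* ((r :* n) :* (r :* n)) :* y) refl s r n t x y)
      (units y))
    where
    -- Here `x₀`, `x₁`, `y`, `y₁` are n times α, t - α, β, t - β. The bilinear weights on the
    -- square, such as (t - α)(t - β)/t, thus acquire the common factor 1/(t n²), which is `q`.
    q  = s *ℚ (r *ℚ r)
    x₀ = n *ℚ x +ℚ -ℚ y
    x₁ = y +ℚ n *ℚ t +ℚ -ℚ (n *ℚ x)
    y₁ = n *ℚ t +ℚ -ℚ y

    0≤q : 0ℚ ≤ℚ q
    0≤q = *-nonneg 0≤s (*-nonneg 0≤r 0≤r)

    -- The ring solver cannot use `st≡1` and `rn≡1`, so the three identities above carry these
    -- products as factors, which are removed here.
    units : ∀ z → s *ℚ t *ℚ (r *ℚ n *ℚ (r *ℚ n)) *ℚ z ≡ z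
    units z = trans (cong₂ (λ u v → u *ℚ (v *ℚ v) *ℚ z) st≡1 rn≡1) (ℚₚ.*-identityˡ z)

Good : ℕ → ℕ → ℕ × ℕ → Set
Good n t (x , y) = y ≤ n * t × y ≤ n * x × n * x ≤ y + n * t

toVec : ℕ × ℕ → Vec ℤ 2
toVec (x , y) = + x ∷ + y ∷ []

toVec-injective : ∀ {p q} → toVec p ≡ toVec q → p ≡ q
toVec-injective refl = refl

module _ (n t : ℕ) where

  ℕ→ℚ-n*t+ : ∀ y → ℕ→ℚ y +ℚ ℕ→ℚ n *ℚ ℕ→ℚ t ≡ ℕ→ℚ (y + n * t)
  ℕ→ℚ-n*t+ y = trans (cong (ℕ→ℚ y +ℚ_) (sym (ℕ→ℚ-* n t))) (sym (ℕ→ℚ-+ y (n * t)))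

  good⇒inDilate : 1 ≤ n → 1 ≤ t → ∀ p → Good n t p → InDilate (parallelogram n) t (toVec p)
  good⇒inDilate 1≤n 1≤t (x , y) (y≤nt , y≤nx , nx≤) with reciprocal n 1≤n | reciprocal t 1≤t
  ... | r , 0≤r , rn≡1 | s , 0≤s , st≡1 = from-weights (ineqs⇒weights (ℕ→ℚ n) (ℕ→ℚ-nonneg n)
    (ℕ→ℚ t) (ℕ→ℚ x) (ℕ→ℚ y) 0≤s 0≤r st≡1 rn≡1
    (ineqs (ℕ→ℚ-nonneg y)
      (subst (ℕ→ℚ y ≤ℚ_) (ℕ→ℚ-* n t) (mono y≤nt))
      (subst (ℕ→ℚ y ≤ℚ_) (ℕ→ℚ-* n x) (mono y≤nx))
      (subst₂ _≤ℚ_ (ℕ→ℚ-* n x) (sym (ℕ→ℚ-n*t+ y)) (mono nx≤))))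
    where
    mono : ∀ {a b} → a ≤ b → ℕ→ℚ a ≤ℚ ℕ→ℚ b
    mono {a} {b} a≤b = ℤ→ℚ-mono-≤ (+ a) (+ b) (ℤ.+≤+ a≤b)

    from-weights : Weights (ℕ→ℚ n) (ℕ→ℚ-nonneg n) (ℕ→ℚ t) (ℕ→ℚ x) (ℕ→ℚ y) →
      InDilate (parallelogram n) t (toVec (x , y))
    from-weights (weights {a} {b} {c} {f} 0≤a 0≤b 0≤c 0≤f st sx sy) =
      fromᶜ (parallelogram n) t (toVec (x , y)) (μ , nonneg , st , at)
      where
      μ : Fin 4 → ℚ
      μ zero                   = a
      μ (suc zero)             = b
      μ (suc (suc zero))       = c
      μ (suc (suc (suc zero))) = f

      nonneg : ∀ j → 0ℚ ≤ℚ μ j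
      nonneg zero                   = 0≤a
      nonneg (suc zero)             = 0≤b
      nonneg (suc (suc zero))       = 0≤c
      nonneg (suc (suc (suc zero))) = 0≤f

      at : ∀ i → sumℚ (λ j → μ j *ℚ coord (parallelogram n) i j) ≡ ℤ→ℚ (lookup (toVec (x , y)) i)
      at zero       = sx
      at (suc zero) = sy

  inDilate⇒ineqs : ∀ i j → InDilate (parallelogram n) t (i ∷ j ∷ []) →
    Inequalities (ℕ→ℚ n) (ℕ→ℚ-nonneg n) (ℕ→ℚ t) (ℤ→ℚ i) (ℤ→ℚ j)
  inDilate⇒ineqs i j p with toᶜ (parallelogram n) t (i ∷ j ∷ []) p
  ... | μ , nonneg , st , at = weights⇒ineqs (ℕ→ℚ n) (ℕ→ℚ-nonneg n) (weights
    (nonneg zero) (nonneg (suc zero)) (nonneg (suc (suc zero))) (nonneg (suc (suc (suc zero))))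
    st (at zero) (at (suc zero)))

  inDilate⇒good : 1 ≤ n → ∀ z → InDilate (parallelogram n) t z →
    Σ[ p ∈ ℕ × ℕ ] (z ≡ toVec p × Good n t p)
  inDilate⇒good 1≤n (i ∷ j ∷ []) p = integral i j
      (ℤ→ℚ-cancel-≤ (+ 0) j (0≤y q))
      (ℤ→ℚ-cancel-≤ j (+ (n * t)) (subst (ℤ→ℚ j ≤ℚ_) (sym (ℕ→ℚ-* n t)) (y≤nt q)))
      (ℤ→ℚ-cancel-≤ j (+ n ℤ.* i) (subst (ℤ→ℚ j ≤ℚ_) (sym (ℤ→ℚ-* (+ n) i)) (y≤nx q)))
      (ℤ→ℚ-cancel-≤ (+ n ℤ.* i) (j ℤ.+ + (n * t)) (subst₂ _≤ℚ_ (sym (ℤ→ℚ-* (+ n) i))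
        (trans (cong (ℤ→ℚ j +ℚ_) (sym (ℕ→ℚ-* n t))) (sym (ℤ→ℚ-+ j (+ (n * t))))) (nx≤ q)))
    where
    open Inequalities
    q = inDilate⇒ineqs i j p

    instance
      n-pos : ℤ.Positive (+ n)
      n-pos = ℤ.positive (ℤ.+<+ 1≤n)

    integral : ∀ i j → + 0 ℤ.≤ j → j ℤ.≤ + (n * t) → j ℤ.≤ + n ℤ.* i →
      + n ℤ.* i ℤ.≤ j ℤ.+ + (n * t) → Σ[ p ∈ ℕ × ℕ ] (i ∷ j ∷ [] ≡ toVec p × Good n t p)
    integral (+ x) (+ y) _ y≤nt y≤nx nx≤ = (x , y) , refl ,
      ℤₚ.drop‿+≤+ y≤nt ,
      ℤₚ.drop‿+≤+ (subst (+ y ℤ.≤_) (sym (ℤₚ.pos-* n x)) y≤nx) ,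
      ℤₚ.drop‿+≤+ (subst (ℤ._≤ + (y + n * t)) (sym (ℤₚ.pos-* n x)) nx≤)
    -- A negative first coordinate is excluded by 0 ≤ y ≤ nx and n > 0.
    integral ℤ.-[1+ x ] (+ y) _ _ y≤nx _ with ℤₚ.*-cancelˡ-≤-pos (+ 0) ℤ.-[1+ x ] (+ n)
      (ℤₚ.≤-trans (ℤₚ.≤-reflexive (ℤₚ.*-zeroʳ (+ n))) (ℤₚ.≤-trans (ℤ.+≤+ z≤n) y≤nx))
    ... | ()

-- Enumeration of the lattice points

module Points (n : ℕ) .{{_ : NonZero n}} (t : ℕ) where

  -- At height y the dilate is the interval from y/n to y/n + t. Without its left end it contains
  -- exactly t integers, starting just above the floor of y/n; the n t rows below the top one make
  -- up `inner`. The left ends are integral only at heights n q with q ≤ t, which gives `left`. The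
  -- rest of the top row is `top`.
  inner left top points : List (ℕ × ℕ)
  inner  = cartesianProductWith (λ y j → y / n + suc j , y) (upTo (n * t)) (upTo t)
  left   = List.map (λ q → q , n * q) (upTo (suc t))
  top  = List.map (λ j → t + suc j , n * t) (upTo t)
  points = inner List.++ left List.++ top

  length-points : length points ≡ n * t * t + (suc t + t)
  length-points = trans (length-++ inner) (cong₂ _+_
    (trans (length-cartesianProductWith _ (upTo (n * t)) (upTo t))
      (cong₂ _*_ (length-upTo (n * t)) (length-upTo t)))
    (trans (length-++ left) (cong₂ _+_
      (trans (length-map _ (upTo (suc t))) (length-upTo (suc t)))
      (trans (length-map _ (upTo t)) (length-upTo t)))))

  y<n*suc[y/n] : ∀ y → y < n + n * (y / n)
  y<n*suc[y/n] y = begin-strict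
    y                    ≡⟨ ℕ÷.m≡m%n+[m/n]*n y n ⟩
    y % n + y / n * n    <⟨ ℕₚ.+-monoˡ-< (y / n * n) (ℕ÷.m%n<n y n) ⟩
    n + y / n * n        ≡⟨ cong (λ z → n + z) (ℕₚ.*-comm (y / n) n) ⟩
    n + n * (y / n)      ∎
    where open ℕₚ.≤-Reasoning

  n*[y/n]≤y : ∀ y → n * (y / n) ≤ y
  n*[y/n]≤y y = subst (_≤ y) (ℕₚ.*-comm (y / n) n) (ℕ÷.m/n*n≤m y n)

  -- These conditions make disjointness visible: `InnerAt` is strict at the left edge and at the
  -- top, and the other two are separated by x ≤ t against t < x.
  InnerAt LeftAt TopAt : ℕ × ℕ → Set
  InnerAt (x , y) = y < n * t × y < n * x × n * x ≤ y + n * t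
  LeftAt  (x , y) = n * x ≡ y × x ≤ t
  TopAt (x , y) = y ≡ n * t × t < x × x ≤ t + t

  inner⁻ : ∀ {p} → p ∈ inner → InnerAt p
  inner⁻ p∈ with ∈-cartesianProductWith⁻ _ (upTo (n * t)) (upTo t) p∈
  ... | y , j , y∈ , j∈ , refl = ∈-upTo⁻ y∈ , lower , upper
    where
    open ℕₚ.≤-Reasoning
    lower : y < n * (y / n + suc j)
    lower = begin-strict
      y                        <⟨ y<n*suc[y/n] y ⟩
      n + n * (y / n)          ≡⟨ sym (ℕₚ.*-suc n (y / n)) ⟩
      n * suc (y / n)          ≤⟨ ℕₚ.*-monoʳ-≤ n (ℕₚ.m<m+n (y / n) (s≤s z≤n)) ⟩
      n * (y / n + suc j)      ∎
    upper : n * (y / n + suc j) ≤ y + n * t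
    upper = begin
      n * (y / n + suc j)       ≡⟨ ℕₚ.*-distribˡ-+ n (y / n) (suc j) ⟩
      n * (y / n) + n * suc j   ≤⟨ ℕₚ.+-mono-≤ (n*[y/n]≤y y) (ℕₚ.*-monoʳ-≤ n (∈-upTo⁻ j∈)) ⟩
      y + n * t                 ∎

  inner⁺ : ∀ p → InnerAt p → p ∈ inner
  inner⁺ (x , y) (y<nt , y<nx , nx≤)
    with ℕₚ.m≤n⇒∃[o]m+o≡n {suc (y / n)} {x} (ℕ÷.m<n*o⇒m/o<n (subst (y <_) (ℕₚ.*-comm n x) y<nx))
  ... | j , refl = subst (λ x → (x , y) ∈ inner) (ℕₚ.+-suc (y / n) j)
    (∈-cartesianProductWith⁺ (λ y j → y / n + suc j , y) (∈-upTo⁺ y<nt) (∈-upTo⁺ j<t))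
    where
    open ℕₚ.≤-Reasoning
    q = y / n
    j<t : j < t
    j<t = ℕₚ.+-cancelˡ-< (suc q) j t (ℕₚ.*-cancelˡ-< n _ _ (begin-strict
      n * (suc q + j)      ≤⟨ nx≤ ⟩
      y + n * t            <⟨ ℕₚ.+-monoˡ-< (n * t) (y<n*suc[y/n] y) ⟩
      n + n * q + n * t    ≡⟨ cong (_+ n * t) (sym (ℕₚ.*-suc n q)) ⟩
      n * suc q + n * t    ≡⟨ sym (ℕₚ.*-distribˡ-+ n (suc q) t) ⟩
      n * (suc q + t)      ∎))

  left⁻ : ∀ {p} → p ∈ left → LeftAt p
  left⁻ p∈ with ∈-map⁻ _ p∈
  ... | q , q∈ , refl = refl , ℕₚ.≤-pred (∈-upTo⁻ q∈)

  left⁺ : ∀ p → LeftAt p → p ∈ left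
  left⁺ (x , _) (refl , x≤t) = ∈-map⁺ (λ q → q , n * q) (∈-upTo⁺ (s≤s x≤t))

  top⁻ : ∀ {p} → p ∈ top → TopAt p
  top⁻ p∈ with ∈-map⁻ _ p∈
  ... | j , j∈ , refl = refl , ℕₚ.m<m+n t (s≤s z≤n) , ℕₚ.+-monoʳ-≤ t (∈-upTo⁻ j∈)

  top⁺ : ∀ p → TopAt p → p ∈ top
  top⁺ (x , _) (refl , t<x , x≤2t) with ℕₚ.m≤n⇒∃[o]m+o≡n {suc t} {x} t<x
  ... | j , refl = subst (λ x → (x , n * t) ∈ top) (ℕₚ.+-suc t j)
    (∈-map⁺ (λ j → t + suc j , n * t) (∈-upTo⁺
      (ℕₚ.+-cancelˡ-≤ t (suc j) t (subst (_≤ t + t) (sym (ℕₚ.+-suc t j)) x≤2t))))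

  points⁻ : ∀ p → p ∈ points → Good n t p
  points⁻ (x , y) p∈ with ∈-++⁻ inner p∈
  ... | inj₁ ∈inner = let y<nt , y<nx , nx≤ = inner⁻ ∈inner in ℕₚ.<⇒≤ y<nt , ℕₚ.<⇒≤ y<nx , nx≤
  ... | inj₂ p∈′ with ∈-++⁻ left p∈′
  ...   | inj₁ ∈left with left⁻ ∈left
  ...     | refl , x≤t = ℕₚ.*-monoʳ-≤ n x≤t , ℕₚ.≤-refl , ℕₚ.m≤m+n (n * x) (n * t)
  points⁻ (x , y) p∈ | inj₂ p∈′ | inj₂ ∈top with top⁻ ∈top
  ...     | refl , t<x , x≤2t = ℕₚ.≤-refl , ℕₚ.*-monoʳ-≤ n (ℕₚ.<⇒≤ t<x) ,
    subst (n * x ≤_) (ℕₚ.*-distribˡ-+ n t t) (ℕₚ.*-monoʳ-≤ n x≤2t)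

  points⁺ : ∀ p → Good n t p → p ∈ points
  points⁺ (x , y) (y≤nt , y≤nx , nx≤) with ℕₚ.m≤n⇒m<n∨m≡n y≤nx
  ... | inj₂ refl = ∈-++⁺ʳ inner (∈-++⁺ˡ (left⁺ (x , y) (refl , ℕₚ.*-cancelˡ-≤ n y≤nt)))
  ... | inj₁ y<nx with ℕₚ.m≤n⇒m<n∨m≡n y≤nt
  ...   | inj₁ y<nt = ∈-++⁺ˡ (inner⁺ (x , y) (y<nt , y<nx , nx≤))
  ...   | inj₂ refl = ∈-++⁺ʳ inner (∈-++⁺ʳ left (top⁺ (x , y) (refl ,
    ℕₚ.*-cancelˡ-< n t x y<nx , ℕₚ.*-cancelˡ-≤ n (subst (n * x ≤_) (sym (ℕₚ.*-distribˡ-+ n t t)) nx≤))))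

  points-unique : Unique points
  points-unique = Uniqueₚ.++⁺
    (Uniqueₚ.cartesianProductWith⁺ _
      (λ eq → cong proj₂ eq , inner-injective eq)
      (Uniqueₚ.upTo⁺ (n * t)) (Uniqueₚ.upTo⁺ t))
    (Uniqueₚ.++⁺
      (Uniqueₚ.map⁺ (cong proj₁) (Uniqueₚ.upTo⁺ (suc t)))
      (Uniqueₚ.map⁺ (λ eq → ℕₚ.suc-injective (ℕₚ.+-cancelˡ-≡ t _ _ (cong proj₁ eq))) (Uniqueₚ.upTo⁺ t))
      λ { (∈left , ∈top) → ℕₚ.<⇒≱ (proj₁ (proj₂ (top⁻ ∈top))) (proj₂ (left⁻ ∈left)) })
    λ { (∈inner , ∈rest) → inner-disjoint (inner⁻ ∈inner) (∈-++⁻ left ∈rest) }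
    where
    inner-injective : ∀ {y y′ j j′} → (y / n + suc j , y) ≡ (y′ / n + suc j′ , y′) → j ≡ j′
    inner-injective {y} eq with cong proj₂ eq
    ... | refl = ℕₚ.suc-injective (ℕₚ.+-cancelˡ-≡ (y / n) _ _ (cong proj₁ eq))

    inner-disjoint : ∀ {p} → InnerAt p → ¬ (p ∈ left ⊎ p ∈ top)
    inner-disjoint (_ , y<nx , _) (inj₁ ∈left) = ℕₚ.<⇒≢ y<nx (sym (proj₁ (left⁻ ∈left)))
    inner-disjoint (y<nt , _ , _) (inj₂ ∈top)  = ℕₚ.<⇒≢ y<nt (proj₁ (top⁻ ∈top))

  latticeCount-parallelogram : 1 ≤ n → 1 ≤ t →
    LatticeCount (parallelogram n) t (n * t * t + (suc t + t))
  latticeCount-parallelogram 1≤n 1≤t =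
    List.map toVec points ,
    Uniqueₚ.map⁺ toVec-injective points-unique ,
    (λ z → (λ z∈ → sound (∈-map⁻ toVec z∈)) , λ z∈ → complete (inDilate⇒good n t 1≤n z z∈)) ,
    trans (length-map toVec points) length-points
    where
    sound : ∀ {z} → ∃ (λ p → p ∈ points × z ≡ toVec p) → InDilate (parallelogram n) t z
    sound (p , p∈ , refl) = good⇒inDilate n t 1≤n 1≤t p (points⁻ p p∈)

    complete : ∀ {z} → Σ[ p ∈ ℕ × ℕ ] (z ≡ toVec p × Good n t p) → z ∈ List.map toVec points
    complete (p , refl , good) = ∈-map⁺ toVec (points⁺ p good)

parallelogram-basis : Fin 3 → Fin 4
parallelogram-basis zero             = zero
parallelogram-basis (suc zero)       = suc zero
parallelogram-basis (suc (suc zero)) = suc (suc zero)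

parallelogram-affIndep : ∀ n → 1 ≤ n → AffIndep (λ i → toℚ^ (parallelogram n (parallelogram-basis i)))
parallelogram-affIndep n 1≤n = affIndep-intro {V = parallelogram n ∘ parallelogram-basis}
  λ { μ (s , e) → vanish μ (reciprocal n 1≤n) s (e zero) (e (suc zero)) }
  where
  -- The system is triangular: the second coordinate gives `c`, the first then gives `b`, and the
  -- total weight gives `a`.
  algebra : ∀ n r a b c → r *ℚ n ≡ 1ℚ → a +ℚ (b +ℚ (c +ℚ 0ℚ)) ≡ 0ℚ →
    a *ℚ 0ℚ +ℚ (b *ℚ 1ℚ +ℚ (c *ℚ 1ℚ +ℚ 0ℚ)) ≡ 0ℚ →
    a *ℚ 0ℚ +ℚ (b *ℚ 0ℚ +ℚ (c *ℚ n +ℚ 0ℚ)) ≡ 0ℚ → a ≡ 0ℚ × b ≡ 0ℚ × c ≡ 0ℚ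
  algebra n r a b c rn≡1 s x y = a≡0 , b≡0 , c≡0
    where
    c≡0 : c ≡ 0ℚ
    c≡0 = begin
      c                 ≡⟨ sym (ℚₚ.*-identityˡ c) ⟩
      1ℚ *ℚ c           ≡⟨ cong (_*ℚ c) (sym rn≡1) ⟩
      r *ℚ n *ℚ c       ≡⟨ solve 5 (λ n r a b c → r :* n :* c :=
        r :* (a :* con 0ℚ :+ (b :* con 0ℚ :+ (c :* n :+ con 0ℚ)))) refl n r a b c ⟩
      r *ℚ _            ≡⟨ cong (r *ℚ_) y ⟩
      r *ℚ 0ℚ           ≡⟨ ℚₚ.*-zeroʳ r ⟩
      0ℚ                ∎
      where open ≡-Reasoning
    b≡0 : b ≡ 0ℚ
    b≡0 = trans (solve 3 (λ a b c → b := a :* con 0ℚ :+ (b :* con 1ℚ :+ (c :* con 1ℚ :+ con 0ℚ)) :+ :- c) refl a b c)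
      (cong₂ (λ u v → u +ℚ -ℚ v) x c≡0)
    a≡0 : a ≡ 0ℚ
    a≡0 = trans (solve 3 (λ a b c → a := a :+ (b :+ (c :+ con 0ℚ)) :+ (:- b :+ :- c)) refl a b c)
      (cong₂ _+ℚ_ s (cong₂ (λ u v → -ℚ u +ℚ -ℚ v) b≡0 c≡0))

  vanish : ∀ (μ : Fin 3 → ℚ) → Σ[ r ∈ ℚ ] (0ℚ ≤ℚ r × r *ℚ ℕ→ℚ n ≡ 1ℚ) →
    sumℚ μ ≡ 0ℚ →
    sumℚ (λ j → μ j *ℚ coord (parallelogram n ∘ parallelogram-basis) zero j) ≡ 0ℚ →
    sumℚ (λ j → μ j *ℚ coord (parallelogram n ∘ parallelogram-basis) (suc zero) j) ≡ 0ℚ →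
    ∀ j → μ j ≡ 0ℚ
  vanish μ (r , _ , rn≡1) s x y = λ
    { zero → proj₁ abc ; (suc zero) → proj₁ (proj₂ abc) ; (suc (suc zero)) → proj₂ (proj₂ abc) }
    where abc = algebra (ℕ→ℚ n) r (μ zero) (μ (suc zero)) (μ (suc (suc zero))) rn≡1 s x y

-- Dilates

dilate : ℕ → (Fin k → Vec ℤ N) → Fin k → Vec ℤ N
dilate m V j = Vec.map (+ m ℤ.*_) (V j)

coord-dilate : ∀ m (V : Fin k → Vec ℤ N) c j → coord (dilate m V) c j ≡ ℕ→ℚ m *ℚ coord V c j
coord-dilate m V c j = trans (cong ℤ→ℚ (lookup-map c (+ m ℤ.*_) (V j))) (ℤ→ℚ-* (+ m) (lookup (V j) c))

comb-dilate : ∀ m (V : Fin k → Vec ℤ N) (μ : Fin k → ℚ) c →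
  sumℚ (λ j → μ j *ℚ coord (dilate m V) c j) ≡ ℕ→ℚ m *ℚ sumℚ (λ j → μ j *ℚ coord V c j)
comb-dilate m V μ c = trans
  (sum-cong λ j → trans (cong (μ j *ℚ_) (coord-dilate m V c j)) (exchange (μ j) (ℕ→ℚ m) (coord V c j)))
  (sum-*ˡ (ℕ→ℚ m) (λ j → μ j *ℚ coord V c j))
  where
  exchange : ∀ a b c → a *ℚ (b *ℚ c) ≡ b *ℚ (a *ℚ c)
  exchange = solve 3 (λ a b c → a :* (b :* c) := b :* (a :* c)) refl

module _ (m : ℕ) (1≤m : 1 ≤ m) where

  private
    r = proj₁ (reciprocal m 1≤m)
    0≤r = proj₁ (proj₂ (reciprocal m 1≤m))
    rm≡1 = proj₂ (proj₂ (reciprocal m 1≤m))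

    unscale : ∀ p → r *ℚ (ℕ→ℚ m *ℚ p) ≡ p
    unscale p = trans (sym (ℚₚ.*-assoc r (ℕ→ℚ m) p))
      (trans (cong (_*ℚ p) rm≡1) (ℚₚ.*-identityˡ p))

  -- The sets t · (mP) and (mt) · P coincide: dividing weights of mass mt by m leaves mass t, and
  -- the enlarged vertices make up for the factor.
  inDilate-dilate⁺ : ∀ (V : Fin k → Vec ℤ N) t x → InDilate V (m * t) x → InDilate (dilate m V) t x
  inDilate-dilate⁺ V t x p with toᶜ V (m * t) x p
  ... | μ , nn , s , e = fromᶜ (dilate m V) t x
    ( (λ j → r *ℚ μ j)
    , (λ j → *-nonneg 0≤r (nn j))
    , trans (sum-*ˡ r μ) (trans (cong (r *ℚ_) (trans s (ℕ→ℚ-* m t))) (unscale (ℕ→ℚ t)))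
    , λ c → trans (comb-dilate m V (λ j → r *ℚ μ j) c) (trans
        (cong (ℕ→ℚ m *ℚ_) (trans (sum-cong λ j → ℚₚ.*-assoc r (μ j) (coord V c j))
          (sum-*ˡ r (λ j → μ j *ℚ coord V c j))))
        (trans (cancel (ℕ→ℚ m) r (sumℚ (λ j → μ j *ℚ coord V c j)) rm≡1) (e c))) )
    where
    cancel : ∀ m r p → r *ℚ m ≡ 1ℚ → m *ℚ (r *ℚ p) ≡ p
    cancel m r p eq = trans (sym (ℚₚ.*-assoc m r p))
      (trans (cong (_*ℚ p) (trans (ℚₚ.*-comm m r) eq)) (ℚₚ.*-identityˡ p))

  inDilate-dilate⁻ : ∀ (V : Fin k → Vec ℤ N) t x → InDilate (dilate m V) t x → InDilate V (m * t) x
  inDilate-dilate⁻ V t x p with toᶜ (dilate m V) t x p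
  ... | μ , nn , s , e = fromᶜ V (m * t) x
    ( (λ j → ℕ→ℚ m *ℚ μ j)
    , (λ j → *-nonneg (ℕ→ℚ-nonneg m) (nn j))
    , trans (sum-*ˡ (ℕ→ℚ m) μ) (trans (cong (ℕ→ℚ m *ℚ_) s) (sym (ℕ→ℚ-* m t)))
    , λ c → trans (sum-cong λ j → ℚₚ.*-assoc (ℕ→ℚ m) (μ j) (coord V c j))
        (trans (sum-*ˡ (ℕ→ℚ m) (λ j → μ j *ℚ coord V c j))
          (trans (sym (comb-dilate m V μ c)) (e c))) )

  latticeCount-dilate : ∀ (V : Fin k → Vec ℤ N) t a →
    LatticeCount V (m * t) a → LatticeCount (dilate m V) t a
  latticeCount-dilate V t a (L , L! , mem , len) = L , L! ,
    (λ x → (λ x∈ → inDilate-dilate⁺ V t x (proj₁ (mem x) x∈)) ,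
           (λ p → proj₂ (mem x) (inDilate-dilate⁻ V t x p))) , len

  affIndep-dilate⁺ : (V : Fin k → Vec ℤ N) →
    AffIndep (λ i → toℚ^ (V i)) → AffIndep (λ i → toℚ^ (dilate m V i))
  affIndep-dilate⁺ V ind = affIndep-intro {V = dilate m V} λ { μ (s , e) →
    affIndep-elim {V = V} ind μ (s , λ c → trans (sym (unscale (sumℚ (λ j → μ j *ℚ coord V c j))))
      (trans (cong (r *ℚ_) (trans (sym (comb-dilate m V μ c)) (e c))) (ℚₚ.*-zeroʳ r))) }

  affIndep-dilate⁻ : (V : Fin k → Vec ℤ N) →
    AffIndep (λ i → toℚ^ (dilate m V i)) → AffIndep (λ i → toℚ^ (V i))
  affIndep-dilate⁻ V ind = affIndep-intro {V = V} λ { μ (s , e) →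
    affIndep-elim {V = dilate m V} ind μ (s , λ c → trans (comb-dilate m V μ c)
      (trans (cong (ℕ→ℚ m *ℚ_) (e c)) (ℚₚ.*-zeroʳ (ℕ→ℚ m)))) }

  hasDim-dilate : ∀ (V : Fin k → Vec ℤ N) d → HasDim V d → HasDim (dilate m V) d
  hasDim-dilate V d ((b , indep) , dep) =
    (b , affIndep-dilate⁺ (V ∘ b) indep) , λ ι ind → dep ι (affIndep-dilate⁻ (V ∘ ι) ind)

-- Ehrhart polynomials

-- `polyTail` starts in degree 1. With the constant term restored as `e 0`, multiplication by the
-- variable becomes `shift` on coefficients.
poly : ℕ → (ℕ → ℚ) → ℚ → ℚ
poly D e x = e 0 +ℚ polyTail D e x

shift : (ℕ → ℚ) → ℕ → ℚ
shift e zero    = 0ℚ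
shift e (suc i) = e i

poly-suc : ∀ D e x → poly (suc D) e x ≡ poly D e x +ℚ e (suc D) *ℚ (x ^ℚ suc D)
poly-suc D e x = sym (ℚₚ.+-assoc (e 0) (polyTail D e x) (e (suc D) *ℚ (x ^ℚ suc D)))

poly-shift : ∀ D e x → poly (suc D) (shift e) x ≡ x *ℚ poly D e x
poly-shift zero    e x = solve 2 (λ a x →
  con 0ℚ :+ (con 0ℚ :+ a :* (x :* con 1ℚ)) := x :* (a :+ con 0ℚ)) refl (e 0) x
poly-shift (suc D) e x = trans (poly-suc (suc D) (shift e) x)
  (trans (cong (_+ℚ e (suc D) *ℚ (x *ℚ (x *ℚ (x ^ℚ D)))) (poly-shift D e x))
    (solve 5 (λ x a p b y → x :* (a :+ p) :+ b :* (x :* y) := x :* (a :+ (p :+ b :* y))) refl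
      x (e 0) (polyTail D e x) (e (suc D)) (x ^ℚ suc D)))

poly-linear : ∀ D (e f g : ℕ → ℚ) a b x →
  poly D (λ i → e i +ℚ a *ℚ f i +ℚ b *ℚ g i) x ≡ poly D e x +ℚ a *ℚ poly D f x +ℚ b *ℚ poly D g x
poly-linear zero    e f g a b x = solve 5 (λ a b u v w →
  u :+ a :* v :+ b :* w :+ con 0ℚ := u :+ con 0ℚ :+ a :* (v :+ con 0ℚ) :+ b :* (w :+ con 0ℚ)) refl
  a b (e 0) (f 0) (g 0)
poly-linear (suc D) e f g a b x = trans
  (poly-suc D (λ i → e i +ℚ a *ℚ f i +ℚ b *ℚ g i) x)
  (trans (cong (_+ℚ (e (suc D) +ℚ a *ℚ f (suc D) +ℚ b *ℚ g (suc D)) *ℚ (x ^ℚ suc D)) (poly-linear D e f g a b x))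
    (regroup a b (x ^ℚ suc D) (e 0) (f 0) (g 0) (polyTail D e x) (polyTail D f x) (polyTail D g x)
      (e (suc D)) (f (suc D)) (g (suc D))))
  where
  regroup : ∀ a b y u v w p q r s t z →
    (u +ℚ p) +ℚ a *ℚ (v +ℚ q) +ℚ b *ℚ (w +ℚ r) +ℚ (s +ℚ a *ℚ t +ℚ b *ℚ z) *ℚ y ≡
    (u +ℚ (p +ℚ s *ℚ y)) +ℚ a *ℚ (v +ℚ (q +ℚ t *ℚ y)) +ℚ b *ℚ (w +ℚ (r +ℚ z *ℚ y))
  regroup = solve 12 (λ a b y u v w p q r s t z →
    (u :+ p) :+ a :* (v :+ q) :+ b :* (w :+ r) :+ (s :+ a :* t :+ b :* z) :* y :=
    (u :+ (p :+ s :* y)) :+ a :* (v :+ (q :+ t :* y)) :+ b :* (w :+ (r :+ z :* y))) refl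

^ℚ-distrib-* : ∀ a x i → (a *ℚ x) ^ℚ i ≡ (a ^ℚ i) *ℚ (x ^ℚ i)
^ℚ-distrib-* a x zero    = refl
^ℚ-distrib-* a x (suc i) = trans (cong (a *ℚ x *ℚ_) (^ℚ-distrib-* a x i))
  (solve 4 (λ a x p q → a :* x :* (p :* q) := a :* p :* (x :* q)) refl a x (a ^ℚ i) (x ^ℚ i))

-- The coefficients of 1 + Σ_{1≤i≤d} cᵢ (m t)ⁱ as a polynomial in t.
scaled : ℕ → ℚ → (ℕ → ℚ) → ℕ → ℚ
scaled d m c zero    = 1ℚ
scaled d m c (suc i) with suc i ≤? d
... | yes _ = (m ^ℚ suc i) *ℚ c (suc i)
... | no  _ = 0ℚ

scaled-≤ : ∀ d i m c → suc i ≤ d → scaled d m c (suc i) ≡ (m ^ℚ suc i) *ℚ c (suc i)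
scaled-≤ d i m c i≤d with suc i ≤? d
... | yes _   = refl
... | no  i≰d = contradiction i≤d i≰d

scaled-> : ∀ d i m c → d < suc i → scaled d m c (suc i) ≡ 0ℚ
scaled-> d i m c d<i with suc i ≤? d
... | yes i≤d = contradiction i≤d (ℕₚ.<⇒≱ d<i)
... | no  _   = refl

polyTail-scaled : ∀ d m c x → polyTail d c (m *ℚ x) ≡ polyTail d (scaled d m c) x
polyTail-scaled d m c x = go d ℕₚ.≤-refl
  where
  go : ∀ D → D ≤ d → polyTail D c (m *ℚ x) ≡ polyTail D (scaled d m c) x
  go zero    _   = refl
  go (suc D) D≤d = cong₂ _+ℚ_ (go D (ℕₚ.<⇒≤ D≤d)) (begin
    c (suc D) *ℚ ((m *ℚ x) ^ℚ suc D)                ≡⟨ cong (c (suc D) *ℚ_) (^ℚ-distrib-* m x (suc D)) ⟩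
    c (suc D) *ℚ ((m ^ℚ suc D) *ℚ (x ^ℚ suc D))     ≡⟨ sym (ℚₚ.*-assoc (c (suc D)) (m ^ℚ suc D) (x ^ℚ suc D)) ⟩
    c (suc D) *ℚ (m ^ℚ suc D) *ℚ (x ^ℚ suc D)       ≡⟨ cong (_*ℚ (x ^ℚ suc D)) (ℚₚ.*-comm (c (suc D)) (m ^ℚ suc D)) ⟩
    (m ^ℚ suc D) *ℚ c (suc D) *ℚ (x ^ℚ suc D)       ≡⟨ cong (_*ℚ (x ^ℚ suc D)) (sym (scaled-≤ d D m c D≤d)) ⟩
    scaled d m c (suc D) *ℚ (x ^ℚ suc D)            ∎)
    where open ≡-Reasoning

poly-suc-zero : ∀ D e x → e (suc D) ≡ 0ℚ → poly (suc D) e x ≡ poly D e x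
poly-suc-zero D e x eq = cong (e 0 +ℚ_) (trans
  (cong (polyTail D e x +ℚ_) (trans (cong (_*ℚ (x ^ℚ suc D)) eq) (ℚₚ.*-zeroˡ (x ^ℚ suc D))))
  (ℚₚ.+-identityʳ (polyTail D e x)))

-- The coefficients of (Σ eᵢ tⁱ) (1 + 2 t + n t²).
times-parallelogram : ℚ → (ℕ → ℚ) → ℕ → ℚ
times-parallelogram n e i = e i +ℚ 2ℚ *ℚ shift e i +ℚ n *ℚ shift (shift e) i

-- The three summands of `times-parallelogram` are the polynomial times 1, 2t and nt². `IsEhrhart`
-- says nothing about `c` at 0 or above `d`; the values 1 and 0 that `scaled` puts there make the
-- lowest and the highest coefficients of the product correct.
poly-times-parallelogram : ∀ d m n c x →
  1ℚ +ℚ polyTail (suc (suc d)) (times-parallelogram n (scaled d m c)) x ≡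
  (1ℚ +ℚ polyTail d c (m *ℚ x)) *ℚ (1ℚ +ℚ 2ℚ *ℚ x +ℚ n *ℚ (x *ℚ x))
poly-times-parallelogram d m n c x = begin
  1ℚ +ℚ polyTail D (times-parallelogram n e) x
    ≡⟨ cong (_+ℚ polyTail D (times-parallelogram n e) x)
         (solve 1 (λ n → con 1ℚ := con 1ℚ :+ con 2ℚ :* con 0ℚ :+ n :* con 0ℚ) refl n) ⟩
  poly D (times-parallelogram n e) x
    ≡⟨ poly-linear D e (shift e) (shift (shift e)) 2ℚ n x ⟩
  poly D e x +ℚ 2ℚ *ℚ poly D (shift e) x +ℚ n *ℚ poly D (shift (shift e)) x
    ≡⟨ cong₂ (λ u v → u +ℚ 2ℚ *ℚ v +ℚ n *ℚ poly D (shift (shift e)) x)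
         (trans (poly-suc-zero (suc d) e x (scaled-> d (suc d) m c (ℕₚ.m≤n⇒m≤1+n ℕₚ.≤-refl))) top-zero)
         (trans (poly-shift (suc d) e x) (cong (x *ℚ_) top-zero)) ⟩
  P +ℚ 2ℚ *ℚ (x *ℚ P) +ℚ n *ℚ poly D (shift (shift e)) x
    ≡⟨ cong (λ u → P +ℚ 2ℚ *ℚ (x *ℚ P) +ℚ n *ℚ u)
         (trans (poly-shift (suc d) (shift e) x) (cong (x *ℚ_) (poly-shift d e x))) ⟩
  P +ℚ 2ℚ *ℚ (x *ℚ P) +ℚ n *ℚ (x *ℚ (x *ℚ P))
    ≡⟨ solve 3 (λ p x n → p :+ con 2ℚ :* (x :* p) :+ n :* (x :* (x :* p))
         := p :* (con 1ℚ :+ con 2ℚ :* x :+ n :* (x :* x))) refl P x n ⟩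
  P *ℚ (1ℚ +ℚ 2ℚ *ℚ x +ℚ n *ℚ (x *ℚ x))
    ≡⟨ cong (λ p → (1ℚ +ℚ p) *ℚ (1ℚ +ℚ 2ℚ *ℚ x +ℚ n *ℚ (x *ℚ x))) (sym (polyTail-scaled d m c x)) ⟩
  (1ℚ +ℚ polyTail d c (m *ℚ x)) *ℚ (1ℚ +ℚ 2ℚ *ℚ x +ℚ n *ℚ (x *ℚ x)) ∎
  where
  open ≡-Reasoning
  D = suc (suc d)
  e = scaled d m c
  P = poly d e x

  top-zero : poly (suc d) e x ≡ P
  top-zero = poly-suc-zero d e x (scaled-> d d m c ℕₚ.≤-refl)

isEhrhart-dilate-⊗-parallelogram : (V : Fin k → Vec ℤ N) → ∀ d c m n → 1 ≤ m → 1 ≤ n →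
  IsEhrhart V d c →
  IsEhrhart (dilate m V ⊗ parallelogram n) (d + 2) (times-parallelogram (ℕ→ℚ n) (scaled d (ℕ→ℚ m) c))
isEhrhart-dilate-⊗-parallelogram V d c m n 1≤m 1≤n ehr t 1≤t =
  a * b ,
  latticeCount-⊗ (dilate m V) (parallelogram n) t s 0≤s st≡1
    (latticeCount-dilate m 1≤m V t a (proj₁ (proj₂ count)))
    (Points.latticeCount-parallelogram n {{ℕ.>-nonZero 1≤n}} t 1≤n 1≤t) ,
  (begin
    ℕ→ℚ (a * b)
      ≡⟨ ℕ→ℚ-* a b ⟩
    ℕ→ℚ a *ℚ ℕ→ℚ b
      ≡⟨ cong₂ _*ℚ_ (trans (proj₂ (proj₂ count)) (cong (λ x → 1ℚ +ℚ polyTail d c x) (ℕ→ℚ-* m t))) b-value ⟩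
    (1ℚ +ℚ polyTail d c (ℕ→ℚ m *ℚ T)) *ℚ (1ℚ +ℚ 2ℚ *ℚ T +ℚ ℕ→ℚ n *ℚ (T *ℚ T))
      ≡⟨ sym (poly-times-parallelogram d (ℕ→ℚ m) (ℕ→ℚ n) c T) ⟩
    1ℚ +ℚ polyTail (2 + d) h T
      ≡⟨ cong (λ D → 1ℚ +ℚ polyTail D h T) (ℕₚ.+-comm 2 d) ⟩
    1ℚ +ℚ polyTail (d + 2) h T ∎)
  where
  open ≡-Reasoning
  T = ℕ→ℚ t
  h = times-parallelogram (ℕ→ℚ n) (scaled d (ℕ→ℚ m) c)
  count = ehr (m * t) (ℕₚ.*-mono-≤ 1≤m 1≤t)
  a = proj₁ count
  b = n * t * t + (suc t + t)
  s = proj₁ (reciprocal t 1≤t)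
  0≤s = proj₁ (proj₂ (reciprocal t 1≤t))
  st≡1 = proj₂ (proj₂ (reciprocal t 1≤t))

  regroup : ∀ n t → n *ℚ t *ℚ t +ℚ (1ℚ +ℚ t +ℚ t) ≡ 1ℚ +ℚ 2ℚ *ℚ t +ℚ n *ℚ (t *ℚ t)
  regroup = solve 2 (λ n t → n :* t :* t :+ (con 1ℚ :+ t :+ t) :=
    con 1ℚ :+ con 2ℚ :* t :+ n :* (t :* t)) refl

  b-value : ℕ→ℚ b ≡ 1ℚ +ℚ 2ℚ *ℚ T +ℚ ℕ→ℚ n *ℚ (T *ℚ T)
  b-value = trans (ℕ→ℚ-+ (n * t * t) (suc t + t)) (trans
    (cong₂ _+ℚ_
      (trans (ℕ→ℚ-* (n * t) t) (cong (_*ℚ T) (ℕ→ℚ-* n t)))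
      (trans (ℕ→ℚ-+ (suc t) t) (cong (_+ℚ T) (ℕ→ℚ-+ 1 t))))
    (regroup (ℕ→ℚ n) T))

-- Signs

sgn-pos : ∀ p → 0ℚ <ℚ p → sgn p ≡ + 1
sgn-pos p 0<p = go p (ℚ.positive 0<p)
  where
  go : ∀ p → ℚ.Positive p → sgn p ≡ + 1
  go (ℚ.mkℚ ℤ.+[1+ _ ] _ _) _ = refl

sgn-neg : ∀ p → p <ℚ 0ℚ → sgn p ≡ ℤ.-[1+ 0 ]
sgn-neg p p<0 = go p (ℚ.negative p<0)
  where
  go : ∀ p → ℚ.Negative p → sgn p ≡ ℤ.-[1+ 0 ]
  go (ℚ.mkℚ ℤ.-[1+ _ ] _ _) _ = refl

sgn-*-pos : ∀ a p → 0ℚ <ℚ a → sgn (a *ℚ p) ≡ sgn p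
sgn-*-pos a p 0<a with ℚₚ.<-cmp p 0ℚ
... | tri< p<0 _ _ = trans (sgn-neg (a *ℚ p) (ℚₚ.negative⁻¹ (a *ℚ p) {{ℚₚ.pos*neg⇒neg a p}})) (sym (sgn-neg p p<0))
  where instance
    a-pos = ℚ.positive 0<a
    p-neg = ℚ.negative p<0
... | tri≈ _ refl _ = cong sgn (ℚₚ.*-zeroʳ a)
... | tri> _ _ 0<p = trans (sgn-pos (a *ℚ p) (ℚₚ.positive⁻¹ (a *ℚ p) {{ℚₚ.pos*pos⇒pos a p}})) (sym (sgn-pos p 0<p))
  where instance
    a-pos = ℚ.positive 0<a
    p-pos = ℚ.positive 0<p

Eventually : (ℕ → Set) → Set
Eventually P = Σ[ n₀ ∈ ℕ ] (∀ n → n₀ ≤ n → P n)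

-- The denominator is at least 1, so `p` is at most the absolute value of its numerator.
archimedean : ∀ p → Eventually (λ n → p <ℚ ℕ→ℚ n)
archimedean p@(ℚ.mkℚ i d-1 _) = suc ℤ.∣ i ∣ , λ n i<n → ℚₚ.toℚᵘ-cancel-< (begin-strict
  ℚ.toℚᵘ p           <⟨ ℚᵘ.*<* (bound n i<n) ⟩
  mkℚᵘ (+ n) 0       ≃⟨ ℚᵘₚ.≃-sym (ℤ→ℚᵘ (+ n)) ⟩
  ℚ.toℚᵘ (ℕ→ℚ n)     ∎)
  where
  open ℚᵘₚ.≤-Reasoning
  bound : ∀ n → ℤ.∣ i ∣ < n → i ℤ.* + 1 ℤ.< + n ℤ.* + suc d-1
  bound n i<n = subst₂ ℤ._<_ (sym (ℤₚ.*-identityʳ i)) (ℤₚ.pos-* n (suc d-1))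
    (ℤₚ.≤-<-trans (i≤∣i∣ i) (ℤ.+<+ (ℕₚ.<-≤-trans i<n (ℕₚ.m≤m*n n (suc d-1)))))
    where
    i≤∣i∣ : ∀ i → i ℤ.≤ + ℤ.∣ i ∣
    i≤∣i∣ (+ _)        = ℤₚ.≤-refl
    i≤∣i∣ ℤ.-[1+ _ ]  = ℤ.-≤+

-- Any n above -w/z will do.
eventually-pos : ∀ w z → 0ℚ <ℚ z → Eventually (λ n → 0ℚ <ℚ w +ℚ ℕ→ℚ n *ℚ z)
eventually-pos w z 0<z with ÷-inverse z (ℚₚ.<⇒≢ 0<z ∘ sym)
... | r , rz≡1 with archimedean (-ℚ w *ℚ r)
...   | n₀ , large = n₀ , λ n n₀≤n → exceeds (ℕ→ℚ n) (large n n₀≤n)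
  where
  instance z-pos = ℚ.positive 0<z

  exceeds : ∀ q → -ℚ w *ℚ r <ℚ q → 0ℚ <ℚ w +ℚ q *ℚ z
  exceeds q wr<q = subst (_<ℚ w +ℚ q *ℚ z)
    (trans (cong (λ u → w +ℚ u) (trans (ℚₚ.*-assoc (-ℚ w) r z) (cong (-ℚ w *ℚ_) rz≡1)))
      (solve 1 (λ w → w :+ :- w :* con 1ℚ := con 0ℚ) refl w))
    (ℚₚ.+-monoʳ-< w (ℚₚ.*-monoˡ-<-pos z wr<q))

eventually-map : {P Q : ℕ → Set} → (∀ n → P n → Q n) → Eventually P → Eventually Q
eventually-map f (n₀ , p) = n₀ , λ n n₀≤n → f n (p n n₀≤n)

-- A nonzero multiple of n eventually outweighs the constant `w`. The case of negative `z` is the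
-- positive one for -w and -z.
eventually-sgn : ∀ w z → z ≢ 0ℚ → Eventually (λ n → sgn (w +ℚ ℕ→ℚ n *ℚ z) ≡ sgn z)
eventually-sgn w z z≢0 = by-sign (ℚₚ.<-cmp z 0ℚ)
  where
  same-pos : 0ℚ <ℚ z → ∀ q → 0ℚ <ℚ w +ℚ q *ℚ z → sgn (w +ℚ q *ℚ z) ≡ sgn z
  same-pos 0<z q p = trans (sgn-pos (w +ℚ q *ℚ z) p) (sym (sgn-pos z 0<z))

  same-neg : z <ℚ 0ℚ → ∀ q → 0ℚ <ℚ -ℚ w +ℚ q *ℚ -ℚ z → sgn (w +ℚ q *ℚ z) ≡ sgn z
  same-neg z<0 q p = trans
    (sgn-neg (w +ℚ q *ℚ z) (subst (_<ℚ 0ℚ)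
      (solve 3 (λ w q z → :- (:- w :+ q :* :- z) := w :+ q :* z) refl w q z)
      (ℚₚ.neg-antimono-< p)))
    (sym (sgn-neg z z<0))

  by-sign : Tri (z <ℚ 0ℚ) (z ≡ 0ℚ) (0ℚ <ℚ z) → Eventually (λ n → sgn (w +ℚ ℕ→ℚ n *ℚ z) ≡ sgn z)
  by-sign (tri≈ _ z≡0 _) = contradiction z≡0 z≢0
  by-sign (tri> _ _ 0<z) = eventually-map (λ n → same-pos 0<z (ℕ→ℚ n)) (eventually-pos w z 0<z)
  by-sign (tri< z<0 _ _) = eventually-map (λ n → same-neg z<0 (ℕ→ℚ n))
    (eventually-pos (-ℚ w) (-ℚ z) (ℚₚ.neg-antimono-< z<0))

eventually-∀≤ : ∀ {P : ℕ → ℕ → Set} D → (∀ i → i ≤ D → Eventually (P i)) →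
  Eventually (λ n → ∀ i → i ≤ D → P i n)
eventually-∀≤ zero    f with f 0 z≤n
... | n₀ , p = n₀ , λ { n n₀≤n zero z≤n → p n n₀≤n }
eventually-∀≤ {P} (suc D) f with eventually-∀≤ D (λ i i≤D → f i (ℕₚ.m≤n⇒m≤1+n i≤D)) | f (suc D) ℕₚ.≤-refl
... | n₁ , p | n₂ , q = n₁ ℕ.⊔ n₂ , λ n n₀≤n i i≤1+D → pick n n₀≤n i (ℕₚ.m≤n⇒m<n∨m≡n i≤1+D)
  where
  pick : ∀ n → n₁ ℕ.⊔ n₂ ≤ n → ∀ i → i < suc D ⊎ i ≡ suc D → P i n
  pick n n₀≤n i (inj₁ i<1+D) = p n (ℕₚ.m⊔n≤o⇒m≤o n₁ n₂ n₀≤n) i (ℕₚ.≤-pred i<1+D)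
  pick n n₀≤n i (inj₂ refl)  = q n (ℕₚ.m⊔n≤o⇒n≤o n₁ n₂ n₀≤n)

^ℚ-pos : ∀ a i → 0ℚ <ℚ a → 0ℚ <ℚ a ^ℚ i
^ℚ-pos a zero    0<a = ℚₚ.positive⁻¹ 1ℚ
^ℚ-pos a (suc i) 0<a = ℚₚ.positive⁻¹ (a *ℚ (a ^ℚ i)) {{ℚₚ.pos*pos⇒pos a (a ^ℚ i)}}
  where instance
    a-pos  = ℚ.positive 0<a
    aⁱ-pos = ℚ.positive (^ℚ-pos a i 0<a)

sgn-scaled : ∀ d i m c → 0ℚ <ℚ m → 1 ≤ i → i ≤ d → sgn (scaled d m c i) ≡ sgn (c i)
sgn-scaled d (suc i) m c 0<m _ i≤d = trans (cong sgn (scaled-≤ d i m c i≤d))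
  (sgn-*-pos (m ^ℚ suc i) (c (suc i)) (^ℚ-pos m (suc i) 0<m))

scaled-≢0 : ∀ d m c → 0ℚ <ℚ m → (∀ i → 1 ≤ i → i ≤ d → c i ≢ 0ℚ) → ∀ i → i ≤ d → scaled d m c i ≢ 0ℚ
scaled-≢0 d m c 0<m c≢0 zero    _   = λ ()
scaled-≢0 d m c 0<m c≢0 (suc i) i≤d eq = c≢0 (suc i) (s≤s z≤n) i≤d
  (*-cancel-0 (ℚₚ.<⇒≢ (^ℚ-pos m (suc i) 0<m) ∘ sym) (trans (sym (scaled-≤ d i m c i≤d)) eq))

-- In degree 1 the factor of `n` is `shift (shift e) 1`, which is 0, so a condition on `m` alone
-- settles the sign. The constant 2 is twice the constant term of `scaled`.
sgn-linear-coefficient : ∀ d m n c → 1 ≤ d → sgn (2ℚ +ℚ m *ℚ c 1) ≡ sgn (c 1) →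
  sgn (times-parallelogram n (scaled d m c) 1) ≡ sgn (c 1)
sgn-linear-coefficient d m n c 1≤d eq = trans (cong sgn (trans
  (cong (λ z → z +ℚ 2ℚ *ℚ 1ℚ +ℚ n *ℚ 0ℚ) (scaled-≤ d 0 m c 1≤d))
  (solve 3 (λ m n c → m :* con 1ℚ :* c :+ con 2ℚ :* con 1ℚ :+ n :* con 0ℚ := con 2ℚ :+ m :* c) refl
    m n (c 1)))) eq

theorem6p3 : (d : ℕ) → 3 ≤ d → (N k : ℕ) → (V : Fin k → Vec ℤ N) → (c : ℕ → ℚ) →
    HasDim V d → IsEhrhart V d c → (∀ i → 1 ≤ i → i ≤ d → c i ≢ 0ℚ) →
    Σ[ N′ ∈ ℕ ] Σ[ k′ ∈ ℕ ] Σ[ W ∈ (Fin k′ → Vec ℤ N′) ] Σ[ h ∈ (ℕ → ℚ) ]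
    (HasDim W (d + 2) × IsEhrhart W (d + 2) h ×
    (∀ i → 4 ≤ i → i ≤ d → sgn (h i) ≡ sgn (c (i ∸ 2))) ×
    sgn (h 2) ≡ + 1 × sgn (h 1) ≡ sgn (c 1) × sgn (h 3) ≡ sgn (c 1))
theorem6p3 d 3≤d N k V c dimV ehrV c≢0 =
  N + 2 , k * 4 , dilate scale V ⊗ parallelogram height , h ,
  hasDim-⊗ (dilate scale V) (parallelogram height) parallelogram-basis (parallelogram-affIndep height (s≤s z≤n))
    (hasDim-dilate scale (s≤s z≤n) V d dimV) ,
  isEhrhart-dilate-⊗-parallelogram V d c scale height (s≤s z≤n) (s≤s z≤n) ehrV ,
  high ,
  -- Since `e 0` is 1 by definition, its sign computes to + 1.
  large-height 0 z≤n ,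
  sgn-linear-coefficient d (ℕ→ℚ scale) (ℕ→ℚ height) c 1≤d (proj₂ scale₀ scale (ℕₚ.n≤1+n (proj₁ scale₀))) ,
  trans (large-height 1 1≤d) (sgn-e 1 (s≤s z≤n) 1≤d)
  where
  1≤d : 1 ≤ d
  1≤d = ℕₚ.≤-trans (s≤s z≤n) 3≤d

  scale₀ = eventually-sgn 2ℚ (c 1) (c≢0 1 (s≤s z≤n) 1≤d)
  -- The successor makes the dilation factor positive even when the threshold is 0; `height` is
  -- formed in the same way.
  scale  = suc (proj₁ scale₀)

  0<scale : 0ℚ <ℚ ℕ→ℚ scale
  0<scale = ℚₚ.positive⁻¹ (ℕ→ℚ scale) {{ℚₚ.normalize-pos scale 1}}

  e = scaled d (ℕ→ℚ scale) c

  sgn-e : ∀ i → 1 ≤ i → i ≤ d → sgn (e i) ≡ sgn (c i)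
  sgn-e i = sgn-scaled d i (ℕ→ℚ scale) c 0<scale

  -- With `e` already fixed, the coefficient of index 2 + i is affine in n with slope `e i`, which
  -- is nonzero for i ≤ d. Finitely many thresholds have a common bound.
  height₀ : Eventually (λ n → ∀ i → i ≤ d → sgn (times-parallelogram (ℕ→ℚ n) e (2 + i)) ≡ sgn (e i))
  height₀ = eventually-∀≤ d (λ i i≤d → eventually-sgn (e (2 + i) +ℚ 2ℚ *ℚ e (1 + i)) (e i)
    (scaled-≢0 d (ℕ→ℚ scale) c 0<scale c≢0 i i≤d))

  height = suc (proj₁ height₀)
  h = times-parallelogram (ℕ→ℚ height) e

  large-height : ∀ i → i ≤ d → sgn (h (2 + i)) ≡ sgn (e i)
  large-height = proj₂ height₀ height (ℕₚ.n≤1+n (proj₁ height₀))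

  high : ∀ i → 4 ≤ i → i ≤ d → sgn (h i) ≡ sgn (c (i ∸ 2))
  high (suc (suc i)) (s≤s (s≤s 2≤i)) i≤d =
    trans (large-height i i≤d′) (sgn-e i (ℕₚ.<⇒≤ 2≤i) i≤d′)
    where i≤d′ = ℕₚ.≤-trans (ℕₚ.m≤n+m i 2) i≤d
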